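{- The parameterized problem \textsc{Vertex Cover}[vc] admits a polynomial boundaried kernelization whose output graph has at most $2(|B|+k)$ vertices, where $B$ is the boundary of the input boundaried graph $G_B$ and $k$ is the size of the given vertex cover of $G$.
   Context: A boundaried graph $G_B$ is a finite simple graph $G$ together with a set $B\subseteq V(G)$ (the boundary). For boundaried graphs $G_B$ and $H_C$ with $V(G)\cap V(H)\subseteq B\cap C$, the gluing $G_B\oplus H_C$ is the simple graph obtained from the disjoint union of $G$ and $H$ by identifying each vertex of $B\cap C$ in $G$ with the identically named vertex in $H$ (an edge present in both is kept once). A pure graph problem is either a decision problem given by an isomorphism-closed class $\Pi$ of graphs, or an isomorphism-invariant optimization (minimization or maximization) problem on graphs; for the latter, $\mathrm{OPT}_\Pi(G)$ denotes the optimum solution value ($+\infty$, resp. $-\infty$, if a minimization, resp. maximization, problem has no feasible solution). Two $B$-boundaried graphs $G_B,G'_B$ are gluing equivalent w.r.t. $\Pi$ and $B$, written $G_B\equiv_{\Pi,B}G'_B$, if: for a decision problem, for every boundaried graph $H_B$ we have $G_B\oplus H_B\in\Pi\iff G'_B\oplus H_B\in\Pi$; for an optimization problem, there is a constant $\Delta\in\mathbb{Z}$ (the offset) such that $\mathrm{OPT}_\Pi(G_B\oplus H_B)=\mathrm{OPT}_\Pi(G'_B\oplus H_B)+\Delta$ for every boundaried graph $H_B$. For a pure graph minimization problem $\rho$, a $\rho$-solution of $G$ is a feasible solution $s$ of $\rho$ on $G$, with value $\rho(G,s)$. For computable $f$, a boundaried kernelization of size $f$ for $\Pi[\rho]$ is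 a polynomial-time algorithm that, given a boundaried graph $G_B$ and a $\rho$-solution $s$ of $G$, outputs a boundaried graph $G'_B$ with $G_B\equiv_{\Pi,B}G'_B$ and a $\rho$-solution $s'$ of $G'$ such that $|G'|,|s'|,\rho(G',s')\le f(|B|+\rho(G,s))$ (here $|\cdot|$ is encoding size), and, if $\Pi$ is an optimization problem, additionally an integer $\Delta$ with $\mathrm{OPT}_\Pi(G_B\oplus H_B)=\mathrm{OPT}_\Pi(G'_B\oplus H_B)+\Delta$ for all $H_B$. It is a polynomial boundaried kernelization if $f$ is bounded by a polynomial. \textsc{Vertex Cover} is the minimization problem whose feasible solutions on $G$ are sets $S\subseteq V(G)$ such that $G-S$ is edgeless, with value $|S|$. \textsc{Vertex Cover}[vc] denotes $\Pi[\rho]$ with $\Pi=\rho=$ \textsc{Vertex Cover}, i.e., the input comes with a vertex cover of size $k$. -}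

module Defs where

open import Data.Bool.Base using (if_then_else_)
open import Data.Empty using (⊥-elim)
open import Data.Integer.Base as ℤ using (ℤ; +_; -[1+_])
open import Data.List.Base using (List; []; _∷_; _++_; map; length; filter; deduplicate)
open import Data.List.Membership.Propositional using (_∈_; _∉_)
open import Data.List.Membership.Propositional.Properties
  using (∈-filter⁺; ∈-filter⁻; ∈-deduplicate⁺; ∈-deduplicate⁻; ∈-++⁺ˡ; ∈-++⁺ʳ; ∈-++⁻; ∈-map⁺; ∈-map⁻)
open import Data.List.Properties using (length-map)
open import Data.List.Relation.Binary.Subset.Propositional using (_⊆_)
open import Data.List.Relation.Unary.All as All using (All; []; _∷_)
import Data.List.Relation.Unary.All.Properties as All
open import Data.List.Relation.Unary.AllPairs using ([]; _∷_)
open import Data.List.Relation.Unary.Any using (here)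
open import Data.List.Relation.Unary.Unique.Propositional using (Unique)
import Data.List.Relation.Unary.Unique.Propositional.Properties as Unique
import Data.List.Relation.Unary.Unique.DecPropositional.Properties as DecUnique
open import Data.Nat.Base using (ℕ; suc; _+_; _*_; _≤_; _<_; _≡ᵇ_)
open import Data.Nat.Binary.Base using (ℕᵇ; zero; 2[1+_]; 1+[2_]; fromℕ)
open import Data.Nat.Properties using (_≟_; <-cmp)
open import Data.List.Membership.DecPropositional _≟_ using (_∈?_; _∉?_)
open import Data.Product.Base using (∃-syntax; _×_; _,_; proj₁; proj₂)
open import Data.Product.Properties using (≡-dec)
open import Data.Sum.Base using (_⊎_; inj₁; inj₂)
open import Relation.Binary.Definitions using (DecidableEquality)
open import Relation.Binary.PropositionalEquality using (_≡_; _≢_; refl; sym; trans; cong; subst; subst₂)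
open import Relation.Nullary using (¬_; Dec; yes; no; _×-dec_)

-- Vertices are named by natural numbers. An edge {u , v} is listed once, as
-- the pair (u , v) with u < v, so there are no loops or parallel edges.
record Graph : Set where
  field
    V          : List ℕ
    E          : List (ℕ × ℕ)
    V-unique   : Unique V
    E-unique   : Unique E
    E-oriented : ∀ {u v} → (u , v) ∈ E → u < v
    E-ends     : ∀ {u v} → (u , v) ∈ E → u ∈ V × v ∈ V

open Graph public

Adj : Graph → ℕ → ℕ → Set
Adj G u v = (u , v) ∈ E G ⊎ (v , u) ∈ E G

Edgeless : Graph → Set
Edgeless G = E G ≡ []

private
  avoids? : (S : List ℕ) (e : ℕ × ℕ) → Dec (proj₁ e ∉ S × proj₂ e ∉ S)
  avoids? S (u , v) = (u ∉? S) ×-dec (v ∉? S)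

infixl 6 _−_
_−_ : Graph → List ℕ → Graph
G − S = record
  { V          = filter (_∉? S) (V G)
  ; E          = filter (avoids? S) (E G)
  ; V-unique   = Unique.filter⁺ (_∉? S) (V-unique G)
  ; E-unique   = Unique.filter⁺ (avoids? S) (E-unique G)
  ; E-oriented = λ e → E-oriented G (proj₁ (∈-filter⁻ (avoids? S) e))
  ; E-ends     = λ e →
      let e∈ , u∉ , v∉ = ∈-filter⁻ (avoids? S) {xs = E G} e
          u∈ , v∈      = E-ends G e∈
      in ∈-filter⁺ (_∉? S) u∈ u∉ , ∈-filter⁺ (_∉? S) v∈ v∉
  }

infix 4 _≅_
record _≅_ (G G′ : Graph) : Set where
  field
    to        : ℕ → ℕ
    from      : ℕ → ℕ
    to-V      : ∀ {u} → u ∈ V G → to u ∈ V G′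
    from-V    : ∀ {u} → u ∈ V G′ → from u ∈ V G
    from∘to   : ∀ {u} → u ∈ V G → from (to u) ≡ u
    to∘from   : ∀ {u} → u ∈ V G′ → to (from u) ≡ u
    to-Adj    : ∀ {u v} → Adj G u v → Adj G′ (to u) (to v)
    from-Adj  : ∀ {u v} → Adj G′ u v → Adj G (from u) (from v)

record BoundariedGraph (B : List ℕ) : Set where
  field
    graph    : Graph
    B-unique : Unique B
    B⊆V      : B ⊆ V graph

open BoundariedGraph public

Gluable : ∀ {B C} → BoundariedGraph B → BoundariedGraph C → Set
Gluable {B} {C} G H = ∀ {v} → v ∈ V (graph G) → v ∈ V (graph H) → v ∈ B × v ∈ C

private
  _≟ₑ_ : DecidableEquality (ℕ × ℕ)
  _≟ₑ_ = ≡-dec _≟_ _≟_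

-- For gluable G and H the shared vertices lie in both boundaries, so the union
-- of the two named graphs is the disjoint union with those vertices identified.
infixl 6 _⊕_
_⊕_ : ∀ {B C} → BoundariedGraph B → BoundariedGraph C → Graph
G ⊕ H = record
  { V          = deduplicate _≟_ vs
  ; E          = deduplicate _≟ₑ_ es
  ; V-unique   = DecUnique.deduplicate-! _≟_ vs
  ; E-unique   = DecUnique.deduplicate-! _≟ₑ_ es
  ; E-oriented = λ e → oriented (∈-++⁻ E₁ (∈-deduplicate⁻ _≟ₑ_ es e))
  ; E-ends     = λ e → ends (∈-++⁻ E₁ (∈-deduplicate⁻ _≟ₑ_ es e))
  }
  where
  V₁ = V (graph G)
  V₂ = V (graph H)
  E₁ = E (graph G)
  E₂ = E (graph H)
  vs = V₁ ++ V₂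
  es = E₁ ++ E₂

  oriented : ∀ {u v} → (u , v) ∈ E₁ ⊎ (u , v) ∈ E₂ → u < v
  oriented (inj₁ e) = E-oriented (graph G) e
  oriented (inj₂ e) = E-oriented (graph H) e

  ends : ∀ {u v} → (u , v) ∈ E₁ ⊎ (u , v) ∈ E₂ →
         u ∈ deduplicate _≟_ vs × v ∈ deduplicate _≟_ vs
  ends (inj₁ e) = let u∈ , v∈ = E-ends (graph G) e in
    ∈-deduplicate⁺ _≟_ (∈-++⁺ˡ u∈) , ∈-deduplicate⁺ _≟_ (∈-++⁺ˡ v∈)
  ends (inj₂ e) = let u∈ , v∈ = E-ends (graph H) e in
    ∈-deduplicate⁺ _≟_ (∈-++⁺ʳ V₁ u∈) , ∈-deduplicate⁺ _≟_ (∈-++⁺ʳ V₁ v∈)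

-- Vertex names occur in data as indivisible symbols of size one: a bound on
-- the size of a graph that keeps prescribed boundary names cannot take the
-- lengths of those names into account.
infixr 5 _∙_
data Tree : Set where
  nil  : Tree
  atom : ℕ → Tree
  _∙_  : Tree → Tree → Tree

size : Tree → ℕ
size nil      = 1
size (atom _) = 1
size (x ∙ y)  = suc (size x + size y)

encodeList : ∀ {A : Set} → (A → Tree) → List A → Tree
encodeList enc []       = nil
encodeList enc (x ∷ xs) = enc x ∙ encodeList enc xs

encodeSet : List ℕ → Tree
encodeSet = encodeList atom

encodeEdge : ℕ × ℕ → Tree
encodeEdge (u , v) = atom u ∙ atom v

encodeGraph : Graph → Tree
encodeGraph G = encodeSet (V G) ∙ encodeList encodeEdge (E G)

encodeBoundaried : ∀ {B} → BoundariedGraph B → Tree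
encodeBoundaried {B} G = encodeGraph (graph G) ∙ encodeSet B

encodeℕᵇ : ℕᵇ → Tree
encodeℕᵇ zero      = nil
encodeℕᵇ 2[1+ n ] = nil ∙ encodeℕᵇ n
encodeℕᵇ 1+[2 n ] = (nil ∙ nil) ∙ encodeℕᵇ n

encodeℤ : ℤ → Tree
encodeℤ (+ n)    = nil ∙ encodeℕᵇ (fromℕ n)
encodeℤ -[1+ n ] = (nil ∙ nil) ∙ encodeℕᵇ (fromℕ (suc n))

-- Structured programs on trees, essentially the WHILE language of N. D. Jones
-- (Computability and Complexity from a Programming Perspective) with a single
-- tree-valued store. In tests, nil is false and every other tree is true.
-- Names can only be copied and compared for equality.
infixr 4 _⨾_
data Program : Set where
  id′ nil′ hd tl eq?  : Program
  ⟨_,_⟩               : Program → Program → Program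
  _⨾_                 : Program → Program → Program
  if′_then_else_      : Program → Program → Program → Program
  while_do′_          : Program → Program → Program

head tail atomEq : Tree → Tree
head (x ∙ _) = x
head _       = nil
tail (_ ∙ y) = y
tail _       = nil
atomEq (atom a ∙ atom b) = if a ≡ᵇ b then nil ∙ nil else nil
atomEq _                 = nil

-- p ⊢ x ⇓ y / n : started on x, the program p halts with result y in n steps.
-- Steps are unit-cost since copying a tree is copying a pointer.
infix 3 _⊢_⇓_/_
data _⊢_⇓_/_ : Program → Tree → Tree → ℕ → Set where
  ⇓id    : ∀ {x} → id′ ⊢ x ⇓ x / 1
  ⇓nil   : ∀ {x} → nil′ ⊢ x ⇓ nil / 1
  ⇓hd    : ∀ {x} → hd ⊢ x ⇓ head x / 1
  ⇓tl    : ∀ {x} → tl ⊢ x ⇓ tail x / 1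
  ⇓eq    : ∀ {x} → eq? ⊢ x ⇓ atomEq x / 1
  ⇓pair  : ∀ {p q x y z m n} → p ⊢ x ⇓ y / m → q ⊢ x ⇓ z / n →
           ⟨ p , q ⟩ ⊢ x ⇓ y ∙ z / suc (m + n)
  ⇓seq   : ∀ {p q x y z m n} → p ⊢ x ⇓ y / m → q ⊢ y ⇓ z / n →
           p ⨾ q ⊢ x ⇓ z / suc (m + n)
  ⇓then  : ∀ {b p q x y z m n} → b ⊢ x ⇓ y / m → y ≢ nil → p ⊢ x ⇓ z / n →
           if′ b then p else q ⊢ x ⇓ z / suc (m + n)
  ⇓else  : ∀ {b p q x z m n} → b ⊢ x ⇓ nil / m → q ⊢ x ⇓ z / n →
           if′ b then p else q ⊢ x ⇓ z / suc (m + n)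
  ⇓stop  : ∀ {b p x m} → b ⊢ x ⇓ nil / m →
           while b do′ p ⊢ x ⇓ x / suc m
  ⇓loop  : ∀ {b p x y z w m n k} → b ⊢ x ⇓ y / m → y ≢ nil → p ⊢ x ⇓ z / n →
           while b do′ p ⊢ z ⇓ w / k →
           while b do′ p ⊢ x ⇓ w / suc (m + n + k)

infixl 6 _:+_
infixl 7 _:*_
data Polynomial : Set where
  con       : ℕ → Polynomial
  X         : Polynomial
  _:+_ _:*_ : Polynomial → Polynomial → Polynomial

⟦_⟧ : Polynomial → ℕ → ℕ
⟦ con c ⟧  n = c
⟦ X ⟧      n = n
⟦ p :+ q ⟧ n = ⟦ p ⟧ n + ⟦ q ⟧ n
⟦ p :* q ⟧ n = ⟦ p ⟧ n * ⟦ q ⟧ n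

-- The size of the result is charged as well: a tree built with sharing can be
-- exponentially larger than the number of steps, and has to be written out.
_⊢_⇓_within_ : Program → Tree → Tree → ℕ → Set
p ⊢ x ⇓ y within t = ∃[ n ] (p ⊢ x ⇓ y / n) × n + size y ≤ t

record MinimizationProblem : Set₁ where
  field
    Solution       : Set
    encodeSolution : Solution → Tree
    Feasible       : Graph → Solution → Set
    value          : Graph → Solution → ℕ
    invariant      : ∀ {G G′} → G ≅ G′ → ∀ s → Feasible G s →
                     ∃[ s′ ] Feasible G′ s′ × value G′ s′ ≡ value G s

open MinimizationProblem public

data ℤ∞ : Set where
  fin : ℤ → ℤ∞
  +∞  : ℤ∞

infixl 6 _⊞_
_⊞_ : ℤ∞ → ℤ → ℤ∞
fin v ⊞ Δ = fin (v ℤ.+ Δ)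
+∞    ⊞ Δ = +∞

-- OPT Π G v holds when v is the optimum solution value of Π on G.
data OPT (Π : MinimizationProblem) (G : Graph) : ℤ∞ → Set where
  optimal    : ∀ s → Feasible Π G s →
               (∀ t → Feasible Π G t → value Π G s ≤ value Π G t) →
               OPT Π G (fin (+ value Π G s))
  infeasible : (∀ s → ¬ Feasible Π G s) → OPT Π G +∞

-- As problems are isomorphism-invariant, it suffices to consider those H whose
-- names clash with neither G nor G′ outside of B.
GluingEquivalentWithOffset : (Π : MinimizationProblem) {B : List ℕ} →
                             BoundariedGraph B → BoundariedGraph B → ℤ → Set
GluingEquivalentWithOffset Π {B} G G′ Δ =
  ∀ (H : BoundariedGraph B) → Gluable G H → Gluable G′ H →
  ∃[ v ] OPT Π (G′ ⊕ H) v × OPT Π (G ⊕ H) (v ⊞ Δ)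

GluingEquivalent : (Π : MinimizationProblem) {B : List ℕ} →
                   BoundariedGraph B → BoundariedGraph B → Set
GluingEquivalent Π G G′ = ∃[ Δ ] GluingEquivalentWithOffset Π G G′ Δ

record KernelOutput (ρ : MinimizationProblem) (B : List ℕ) : Set where
  constructor output
  field
    kernel   : BoundariedGraph B
    solution : Solution ρ
    offset   : ℤ

open KernelOutput public

encodeInput : ∀ ρ {B} → BoundariedGraph B → Solution ρ → Tree
encodeInput ρ G s = encodeBoundaried G ∙ encodeSolution ρ s

encodeOutput : ∀ ρ {B} → KernelOutput ρ B → Tree
encodeOutput ρ (output G′ s′ Δ) =
  encodeBoundaried G′ ∙ encodeSolution ρ s′ ∙ encodeℤ Δ

record IsKernel (Π ρ : MinimizationProblem) (f : ℕ → ℕ) {B : List ℕ}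
                (G : BoundariedGraph B) (s : Solution ρ) (out : KernelOutput ρ B) : Set where
  bound : ℕ
  bound = f (length B + value ρ (graph G) s)
  field
    feasible   : Feasible ρ (graph (kernel out)) (solution out)
    equivalent : GluingEquivalentWithOffset Π G (kernel out) (offset out)
    graph≤     : size (encodeGraph (graph (kernel out))) ≤ bound
    solution≤  : size (encodeSolution ρ (solution out)) ≤ bound
    value≤     : value ρ (graph (kernel out)) (solution out) ≤ bound

record BoundariedKernelization (Π ρ : MinimizationProblem) (f : ℕ → ℕ) : Set where
  field
    algorithm : Program
    time      : Polynomial
    result    : ∀ {B} (G : BoundariedGraph B) s → Feasible ρ (graph G) s → KernelOutput ρ B
    computes  : ∀ {B} (G : BoundariedGraph B) s (feasible : Feasible ρ (graph G) s) →
                algorithm ⊢ encodeInput ρ G s ⇓ encodeOutput ρ (result G s feasible)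
                  within ⟦ time ⟧ (size (encodeInput ρ G s))
    correct   : ∀ {B} (G : BoundariedGraph B) s (feasible : Feasible ρ (graph G) s) →
                IsKernel Π ρ f G s (result G s feasible)

open BoundariedKernelization public

-- Computability of the size function need not be demanded separately: f may
-- always be replaced by the polynomial that bounds it.
record PolynomialBoundariedKernelization (Π ρ : MinimizationProblem) : Set where
  field
    f              : ℕ → ℕ
    polynomial     : Polynomial
    f≤polynomial   : ∀ n → f n ≤ ⟦ polynomial ⟧ n
    kernelization  : BoundariedKernelization Π ρ f

open PolynomialBoundariedKernelization public

record IsVertexCover (G : Graph) (S : List ℕ) : Set where
  field
    S-unique : Unique S
    S⊆V      : S ⊆ V G
    edgeless : Edgeless (G − S)

private
  map-unique : ∀ (f : ℕ → ℕ) {P : ℕ → Set} →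
               (∀ {x y} → P x → P y → f x ≡ f y → x ≡ y) →
               ∀ {xs} → (∀ {x} → x ∈ xs → P x) → Unique xs → Unique (map f xs)
  map-unique f inj P []       = []
  map-unique f inj P (x∉ ∷ u) =
    All.map⁺ (All.tabulate λ y∈ fx≡fy →
      All.lookup x∉ y∈ (inj (P (here refl)) (P (Any.there y∈)) fx≡fy))
    ∷ map-unique f inj (λ y∈ → P (Any.there y∈)) u
    where import Data.List.Relation.Unary.Any as Any

  edge-covered : ∀ {G S} → Edgeless (G − S) → ∀ {u v} → (u , v) ∈ E G → u ∈ S ⊎ v ∈ S
  edge-covered {G} {S} empty {u} {v} e with u ∈? S | v ∈? S
  ... | yes u∈ | _      = inj₁ u∈
  ... | no _   | yes v∈ = inj₂ v∈
  ... | no u∉  | no v∉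
    with () ← subst ((u , v) ∈_) empty (∈-filter⁺ (avoids? S) e (u∉ , v∉))

  edgeless-if-covered : ∀ {G S} → (∀ {u v} → (u , v) ∈ E G → u ∈ S ⊎ v ∈ S) → Edgeless (G − S)
  edgeless-if-covered {G} {S} cover with E (G − S) in eq
  ... | []           = refl
  ... | (u , v) ∷ es
    with e , u∉ , v∉ ← ∈-filter⁻ (avoids? S) {xs = E G} (subst ((u , v) ∈_) (sym eq) (here refl))
    with cover e
  ...   | inj₁ u∈ = ⊥-elim (u∉ u∈)
  ...   | inj₂ v∈ = ⊥-elim (v∉ v∈)

  module _ {G G′ : Graph} (i : G ≅ G′) {S : List ℕ} (vc : IsVertexCover G S) where
    open _≅_ i
    open IsVertexCover vc

    pull : ∀ {u} → u ∈ V G′ → from u ∈ S → u ∈ map to S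
    pull u∈V u∈S = subst (_∈ map to S) (to∘from u∈V) (∈-map⁺ to u∈S)

    cover′ : ∀ {u v} → (u , v) ∈ E G′ → u ∈ map to S ⊎ v ∈ map to S
    cover′ e with E-ends G′ e | from-Adj (inj₁ e)
    ... | u∈ , v∈ | inj₁ e₁ with edge-covered {G} edgeless e₁
    ...   | inj₁ u∈S = inj₁ (pull u∈ u∈S)
    ...   | inj₂ v∈S = inj₂ (pull v∈ v∈S)
    cover′ e | u∈ , v∈ | inj₂ e₂ with edge-covered {G} edgeless e₂
    ...   | inj₁ v∈S = inj₂ (pull v∈ v∈S)
    ...   | inj₂ u∈S = inj₁ (pull u∈ u∈S)

    image-isVertexCover : IsVertexCover G′ (map to S)
    image-isVertexCover = record
      { S-unique = map-unique to
          (λ x∈ y∈ eq → trans (sym (from∘to x∈)) (trans (cong from eq) (from∘to y∈)))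
          S⊆V S-unique
      ; S⊆V      = λ y∈ → let x , x∈ , y≡ = ∈-map⁻ to y∈
                          in subst (_∈ V G′) (sym y≡) (to-V (S⊆V x∈))
      ; edgeless = edgeless-if-covered {G′} cover′
      }

VertexCover : MinimizationProblem
VertexCover = record
  { Solution       = List ℕ
  ; encodeSolution = encodeSet
  ; Feasible       = IsVertexCover
  ; value          = λ _ S → length S
  ; invariant      = λ i S vc → map (_≅_.to i) S , image-isVertexCover i vc , length-map (_≅_.to i) S
  }

{-# OPTIONS --safe #-}

-- Let I be the set of vertices outside B and the vertex cover S, an independent
-- set with all neighbours in S. The kernel keeps S, B and the vertices of I that
-- an auction matches into S; the offset is 0. Every s in S has a level, initially
-- 0. A pending x in I takes its neighbour s of least level, s rises by one level,
-- and the former mate of s becomes pending. If all neighbours of x are above level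
-- |S|, then x is discarded. A mate of s is always at most one level above each of
-- its neighbours and a vertex of S without a mate has level 0. When x is discarded, some
-- level g ≤ |S| is empty, so the part D of S above level g is matched, and all
-- neighbours of x and of the mates of D are in D. Hence a vertex cover of the
-- remaining glued graph becomes one that also covers the edges at x when every mate
-- of D in it is replaced by its partner. Each step raises a level or shrinks the
-- set of pending vertices for good, which bounds the number of steps.

module Submission where

open import Data.Bool.Base using (Bool; true; false; not; _∨_; _∧_; if_then_else_)
open import Data.Bool.Properties using (∨-assoc; ∨-comm; ∨-identityʳ)
open import Data.Empty using (⊥; ⊥-elim)
import Data.Integer.Base as ℤ
import Data.Integer.Properties as ℤ
open import Data.List.Base
  using (List; []; _∷_; _++_; _ʳ++_; map; mapMaybe; length; filter; foldl; reverse; upTo; cartesianProduct)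
import Data.List.Extrema.Nat as Extrema
open import Data.List.Membership.Propositional using (_∈_; _∉_; find; lose)
open import Data.List.Membership.Propositional.Properties
open import Data.List.Properties
open import Data.List.Relation.Binary.Permutation.Propositional
  using (_↭_; ↭-refl; ↭-reflexive; ↭-sym; ↭-trans; prep; swap; ↭⇒↭ₛ)
open import Data.List.Relation.Binary.Permutation.Propositional.Properties
  using (∈-resp-↭; shift; ↭-length; ++⁺ˡ; ++⁺ʳ; map⁺; catMaybes-↭)
import Data.List.Relation.Binary.Permutation.Setoid.Properties as ↭ₛ
open import Data.List.Relation.Binary.Subset.Propositional using (_⊆_)
open import Data.List.Relation.Unary.All as All using (All; []; _∷_)
import Data.List.Relation.Unary.All.Properties as All
open import Data.List.Relation.Unary.AllPairs using ([]; _∷_)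
open import Data.List.Relation.Unary.Any as Any using (Any; here; there; any?)
open import Data.List.Relation.Unary.Unique.Propositional using (Unique)
import Data.List.Relation.Unary.Unique.Propositional.Properties as Unique
open import Data.Maybe.Base as Maybe using (Maybe; just; nothing; maybe′)
open import Data.Nat.Base using (ℕ; zero; suc; _+_; _*_; _≤_; _<_; _∸_; z≤n; s≤s; _≡ᵇ_)
open import Data.Nat.ListAction using (sum)
open import Data.Nat.ListAction.Properties using (sum-↭)
open import Data.Nat.Properties hiding (eq?)
open import Data.List.Membership.DecPropositional _≟_ using (_∈?_; _∉?_)
open import Data.Product.Base using (Σ; ∃-syntax; _×_; _,_; proj₁; proj₂; map₂)
open import Data.Sum.Base as Sum using (_⊎_; inj₁; inj₂)
open import Data.Unit.Base using (⊤)
open import Function.Base using (_∘_; id)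
open import Relation.Binary.PropositionalEquality
  using (_≡_; _≢_; refl; sym; trans; cong; cong₂; subst; setoid)
open import Relation.Nullary using (¬_; yes; no; does; _×-dec_; _⊎-dec_)
open import Relation.Nullary.Decidable using (decidable-stable)
open import Relation.Unary using (Decidable)
open import Defs

-- Running times of programs

-- The auction makes at most `|V| + |S| * (|S| + 1)` steps, and each of `|V|`, `|S|` and `|S| + 1`
-- is at most the input size. Every other loop runs along a list no longer than that size.
loops : Polynomial
loops = X :+ X :* X

-- The cost of p when every loop in it makes at most ⟦ loops ⟧ n iterations.
bound : Program → Polynomial
bound id′                     = con 1
bound nil′                    = con 1
bound hd                      = con 1
bound tl                      = con 1
bound eq?                     = con 1
bound ⟨ p , q ⟩               = con 1 :+ (bound p :+ bound q)
bound (p ⨾ q)                 = con 1 :+ (bound p :+ bound q)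
bound (if′ b then p else q)   = con 1 :+ (bound b :+ (bound p :+ bound q))
bound (while b do′ p)         = loops :* (con 1 :+ (bound b :+ bound p)) :+ (con 1 :+ bound b)

-- `N` is meant to be the size of the input of the whole algorithm and not of `x`. With `N` fixed,
-- costs add up along the program text, and only the lengths of traversed lists have to be checked.
record Runs (N : ℕ) (p : Program) (x y : Tree) : Set where
  constructor runs
  field
    {steps} : ℕ
    halts   : p ⊢ x ⇓ y / steps
    steps≤  : steps ≤ ⟦ bound p ⟧ N

private variable
  N : ℕ
  b p q : Program
  x y z : Tree

run-pair : Runs N p x y → Runs N q x z → Runs N ⟨ p , q ⟩ x (y ∙ z)
run-pair (runs h h≤) (runs k k≤) = runs (⇓pair h k) (s≤s (+-mono-≤ h≤ k≤))

infixr 4 _run-⨾_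
_run-⨾_ : Runs N p x y → Runs N q y z → Runs N (p ⨾ q) x z
runs h h≤ run-⨾ runs k k≤ = runs (⇓seq h k) (s≤s (+-mono-≤ h≤ k≤))

run-then : Runs N b x y → y ≢ nil → Runs N p x z → Runs N (if′ b then p else q) x z
run-then (runs h h≤) y≢ (runs k k≤) =
  runs (⇓then h y≢ k) (s≤s (+-mono-≤ h≤ (≤-trans k≤ (m≤m+n _ _))))

run-else : Runs N b x nil → Runs N q x z → Runs N (if′ b then p else q) x z
run-else (runs h h≤) (runs k k≤) =
  runs (⇓else h k) (s≤s (+-mono-≤ h≤ (≤-trans k≤ (m≤n+m _ _))))

encodeBool : Bool → Tree
encodeBool c = if c then nil ∙ nil else nil

true′ : Program
true′ = ⟨ nil′ , nil′ ⟩

Straight : Program → Set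
Straight ⟨ p , q ⟩             = Straight p × Straight q
Straight (p ⨾ q)               = Straight p × Straight q
Straight (if′ b then p else q) = Straight b × Straight p × Straight q
Straight (while b do′ p)       = ⊥
Straight _                     = ⊤

select : Tree → Tree → Tree → Tree
select nil      y z = z
select (atom _) y z = y
select (_ ∙ _)  y z = y

eval : Program → Tree → Tree
eval id′                   x = x
eval nil′                  x = nil
eval hd                    x = head x
eval tl                    x = tail x
eval eq?                   x = atomEq x
eval ⟨ p , q ⟩             x = eval p x ∙ eval q x
eval (p ⨾ q)               x = eval q (eval p x)
eval (if′ b then p else q) x = select (eval b x) (eval p x) (eval q x)
-- A placeholder: `Straight` rules loops out.
eval (while b do′ p)       x = nil

eval-runs : ∀ p → Straight p → ∀ x → Runs N p x (eval p x)
eval-runs id′       _ x = runs ⇓id ≤-refl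
eval-runs nil′      _ x = runs ⇓nil ≤-refl
eval-runs hd        _ x = runs ⇓hd ≤-refl
eval-runs tl        _ x = runs ⇓tl ≤-refl
eval-runs eq?       _ x = runs ⇓eq ≤-refl
eval-runs ⟨ p , q ⟩ (s , t) x = run-pair (eval-runs p s x) (eval-runs q t x)
eval-runs (p ⨾ q)   (s , t) x = eval-runs p s x run-⨾ eval-runs q t _
eval-runs (if′ b then p else q) (r , s , t) x with eval b x | eval-runs b r x
... | nil    | h = run-else h (eval-runs q t x)
... | atom _ | h = run-then h (λ ()) (eval-runs p s x)
... | _ ∙ _  | h = run-then h (λ ()) (eval-runs p s x)

-- For a concrete loop-free program, `Straight p` is a product of unit types, filled in by eta, and
-- `eval` computes the result. So this term settles every loop-free piece by normalization.
straight : {s : Straight p} → Runs N p x (eval p x)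
straight {p} {s = s} = eval-runs p s _

-- The iteration count is kept explicit for the sake of induction; `run-while` then trades it for
-- the uniform `loops`.
record Loops (N n : ℕ) (b p : Program) (x y : Tree) : Set where
  constructor loop
  field
    {steps} : ℕ
    halts   : while b do′ p ⊢ x ⇓ y / steps
    steps≤  : steps ≤ n * suc (⟦ bound b ⟧ N + ⟦ bound p ⟧ N) + suc (⟦ bound b ⟧ N)

loop-stop : ∀ {n} → Runs N b x nil → Loops N n b p x x
loop-stop (runs h h≤) = loop (⇓stop h) (≤-trans (s≤s h≤) (m≤n+m _ _))

loop-step : ∀ {n w} → Runs N b x y → y ≢ nil → Runs N p x z →
            Loops N n b p z w → Loops N (suc n) b p x w
loop-step {N} {b} {p = p} {n = n} (runs h h≤) y≢ (runs k k≤) (loop l l≤) = loop (⇓loop h y≢ k l)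
  (≤-trans (+-mono-≤ (s≤s (+-mono-≤ h≤ k≤)) l≤)
    (≤-reflexive (sym (+-assoc (suc (⟦ bound b ⟧ N + ⟦ bound p ⟧ N)) _ _))))

run-while : ∀ {n} → n ≤ ⟦ loops ⟧ N → Loops N n b p x y → Runs N (while b do′ p) x y
run-while n≤ (loop h h≤) = runs h (≤-trans h≤ (+-monoˡ-≤ _ (*-monoˡ-≤ _ n≤)))

-- Programs on lists

-- Started on (e ∙ a) ∙ xs, replaces the accumulator a by the value of p on
-- (e ∙ a) ∙ (x ∙ …), for each element x of the list xs in turn.
foldP : Program → Program
foldP p = (while tl do′ ⟨ ⟨ hd ⨾ hd , p ⟩ , tl ⨾ tl ⟩) ⨾ hd ⨾ tl

module _ {A C : Set} {encodeA : A → Tree} {encodeC : C → Tree} where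

  fold-loops : ∀ {e} {f : A → C → A} →
    (∀ a c r → Runs N p ((e ∙ encodeA a) ∙ (encodeC c ∙ r)) (encodeA (f a c))) →
    ∀ a cs → Loops N (length cs) tl ⟨ ⟨ hd ⨾ hd , p ⟩ , tl ⨾ tl ⟩
      ((e ∙ encodeA a) ∙ encodeList encodeC cs) ((e ∙ encodeA (foldl f a cs)) ∙ nil)
  fold-loops step a []       = loop-stop straight
  fold-loops step a (c ∷ cs) = loop-step straight (λ ())
    (run-pair (run-pair straight (step a c _)) straight) (fold-loops step _ cs)

  run-fold : ∀ {e} {f : A → C → A} →
    (∀ a c r → Runs N p ((e ∙ encodeA a) ∙ (encodeC c ∙ r)) (encodeA (f a c))) →
    ∀ a cs → length cs ≤ N →
    Runs N (foldP p) ((e ∙ encodeA a) ∙ encodeList encodeC cs) (encodeA (foldl f a cs))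
  run-fold step a cs cs≤ =
    run-while (≤-trans cs≤ (m≤m+n _ _)) (fold-loops step a cs) run-⨾ straight

accP itemP pushP reverseP : Program
accP     = hd ⨾ tl
itemP    = tl ⨾ hd
pushP    = ⟨ itemP , accP ⟩
reverseP = ⟨ ⟨ nil′ , nil′ ⟩ , id′ ⟩ ⨾ foldP pushP

-- The argument is an environment paired with a list. The accumulator starts as `nil`, which encodes
-- both `false` and the empty list.
anyP filterP : Program → Program
anyP p    = ⟨ ⟨ hd , nil′ ⟩ , tl ⟩ ⨾
            foldP (if′ (⟨ hd ⨾ hd , itemP ⟩ ⨾ p) then true′ else accP)
-- Removes the items for which p holds.
filterP p = ⟨ ⟨ hd , nil′ ⟩ , tl ⟩ ⨾
            foldP (if′ (⟨ hd ⨾ hd , itemP ⟩ ⨾ p) then accP else pushP) ⨾ reverseP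

foldl-∨ : ∀ {C : Set} {P : C → Set} (P? : Decidable P) a cs →
          foldl (λ a c → does (P? c) ∨ a) a cs ≡ does (any? P? cs) ∨ a
foldl-∨ P? a []       = refl
foldl-∨ P? a (c ∷ cs) = trans (foldl-∨ P? _ cs)
  (trans (sym (∨-assoc (does (any? P? cs)) _ a))
    (cong (_∨ a) (∨-comm (does (any? P? cs)) (does (P? c)))))

-- Accumulating reverses the order; a final `reverseP` restores it, so that the program produces
-- literally the lists of `G − dr`.
foldl-filter : ∀ {C : Set} {P : C → Set} (P? : Decidable P) a cs →
               foldl (λ a c → if does (P? c) then c ∷ a else a) a cs ≡ filter P? cs ʳ++ a
foldl-filter P? a []       = refl
foldl-filter P? a (c ∷ cs) with does (P? c)
... | true  = foldl-filter P? (c ∷ a) cs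
... | false = foldl-filter P? a cs

module _ {C : Set} {encodeC : C → Tree} where

  run-reverse : ∀ cs → length cs ≤ N →
                Runs N reverseP (encodeList encodeC cs) (encodeList encodeC (reverse cs))
  run-reverse cs cs≤ = straight run-⨾ run-fold {encodeA = encodeList encodeC} (λ a c r → straight) [] cs cs≤

  module _ {P : C → Set} (P? : Decidable P) {e : Tree} where

    run-any : (∀ c → Runs N p (e ∙ encodeC c) (encodeBool (does (P? c)))) →
              ∀ cs → length cs ≤ N →
              Runs N (anyP p) (e ∙ encodeList encodeC cs) (encodeBool (does (any? P? cs)))
    run-any test cs cs≤ =
      subst (λ c → Runs _ _ _ (encodeBool c)) (trans (foldl-∨ P? false cs) (∨-identityʳ _))
        (straight run-⨾ run-fold step false cs cs≤)
      where
      step : ∀ a c r → Runs _ _ ((e ∙ encodeBool a) ∙ (encodeC c ∙ r)) (encodeBool (does (P? c) ∨ a))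
      step a c r with does (P? c) | test c
      ... | true  | h = run-then (straight run-⨾ h) (λ ()) straight
      ... | false | h = run-else (straight run-⨾ h) straight

    run-filter : (t : C → Bool) → (∀ c → does (P? c) ≡ not (t c)) →
                 (∀ c → Runs N p (e ∙ encodeC c) (encodeBool (t c))) →
                 ∀ cs → length cs ≤ N →
                 Runs N (filterP p) (e ∙ encodeList encodeC cs) (encodeList encodeC (filter P? cs))
    run-filter {N} t P≡ test cs cs≤ =
      straight run-⨾ run-fold step [] cs cs≤ run-⨾
      subst (λ ds → Runs N reverseP (encodeList encodeC ds) (encodeList encodeC (filter P? cs)))
        (sym (foldl-filter P? [] cs))
        (subst (λ ds → Runs N reverseP (encodeList encodeC (reverse (filter P? cs))) (encodeList encodeC ds))
          (reverse-involutive (filter P? cs))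
          (run-reverse (reverse (filter P? cs))
            (≤-trans (≤-reflexive (length-reverse (filter P? cs)))
              (≤-trans (length-filter P? cs) cs≤))))
      where
      step : ∀ a c r → Runs N _ ((e ∙ encodeList encodeC a) ∙ (encodeC c ∙ r))
                              (encodeList encodeC (if does (P? c) then c ∷ a else a))
      step a c r rewrite P≡ c with t c | test c
      ... | true  | h = run-then (straight run-⨾ h) (λ ()) straight
      ... | false | h = run-else (straight run-⨾ h) straight

-- Membership and adjacency tests

memberP : Program
memberP = anyP eq?

run-member : ∀ x ys → length ys ≤ N →
             Runs N memberP (atom x ∙ encodeSet ys) (encodeBool (does (x ∈? ys)))
run-member x = run-any (x ≟_) (λ y → straight)

-- Both orientations are tested because an edge is listed once, smaller end first.
Joins : ℕ → ℕ → ℕ × ℕ → Set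
Joins x s (u , v) = (x ≡ u × s ≡ v) ⊎ (x ≡ v × s ≡ u)

joins? : ∀ x s → Decidable (Joins x s)
joins? x s (u , v) = ((x ≟ u) ×-dec (s ≟ v)) ⊎-dec ((x ≟ v) ×-dec (s ≟ u))

Linked : List (ℕ × ℕ) → ℕ → ℕ → Set
Linked es x s = Any (Joins x s) es

linked? : ∀ es x → Decidable (Linked es x)
linked? es x s = any? (joins? x s) es

linkedP : Program
linkedP = anyP (if′ (if′ (⟨ hd ⨾ hd , tl ⨾ hd ⟩ ⨾ eq?) then (⟨ hd ⨾ tl , tl ⨾ tl ⟩ ⨾ eq?) else nil′)
                then true′
                else (if′ (⟨ hd ⨾ hd , tl ⨾ tl ⟩ ⨾ eq?) then (⟨ hd ⨾ tl , tl ⨾ hd ⟩ ⨾ eq?) else nil′))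

run-linked : ∀ es x s → length es ≤ N →
             Runs N linkedP ((atom x ∙ atom s) ∙ encodeList encodeEdge es)
                            (encodeBool (does (linked? es x s)))
run-linked es x s = run-any (joins? x s) test es
  where
  select-∨ : ∀ a b c d → select (select (encodeBool a) (encodeBool b) nil) (nil ∙ nil)
                                (select (encodeBool c) (encodeBool d) nil) ≡
                         encodeBool ((a ∧ b) ∨ (c ∧ d))
  select-∨ true  true  _     _ = refl
  select-∨ true  false true  d = refl
  select-∨ true  false false _ = refl
  select-∨ false _     true  d = refl
  select-∨ false _     false _ = refl

  test : ∀ e → Runs _ _ ((atom x ∙ atom s) ∙ encodeEdge e) (encodeBool (does (joins? x s e)))
  test (u , v) = subst (Runs _ _ _)
    (select-∨ (x ≡ᵇ u) (s ≡ᵇ v) (x ≡ᵇ v) (s ≡ᵇ u)) straight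

-- Raising a slot

-- A slot holds a potential partner s, with its current mate; its level is the
-- number of separators before it.
data Item : Set where
  sep  : Item
  slot : ℕ → Maybe ℕ → Item

Slot : Set
Slot = ℕ × ℕ × Maybe ℕ

slots : ℕ → List Item → List Slot
slots i []             = []
slots i (sep ∷ l)      = slots (suc i) l
slots i (slot s m ∷ l) = (i , s , m) ∷ slots i l

seps : List Item → ℕ
seps []             = 0
seps (sep ∷ l)      = suc (seps l)
seps (slot s m ∷ l) = seps l

slots-≥ : ∀ {i l n s m} → (n , s , m) ∈ slots i l → i ≤ n
slots-≥ {l = sep ∷ l}      n∈         = ≤-trans (n≤1+n _) (slots-≥ {l = l} n∈)
slots-≥ {l = slot s m ∷ l} (here refl) = ≤-refl
slots-≥ {l = slot s m ∷ l} (there n∈)  = slots-≥ {l = l} n∈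

-- With levels marked by separators, going up one level means moving past the next separator, which
-- takes a program no arithmetic. Failure means that the slot is on the top level already.
raise : Item → List Item → Maybe (List Item)
raise e []                = nothing
raise e (sep ∷ l)         = just (sep ∷ e ∷ l)
raise e (d@(slot _ _) ∷ l) = Maybe.map (d ∷_) (raise e l)

module Bump {P : ℕ → Set} (P? : Decidable P) (x : ℕ) where

  -- The list is sorted by level, so the first slot satisfying `P` is one of least level; if that
  -- one cannot rise, no other can. The inner `Maybe` is the former mate.
  bump : List Item → Maybe (Maybe ℕ × List Item)
  bump []             = nothing
  bump (sep ∷ l)      = Maybe.map (map₂ (sep ∷_)) (bump l)
  bump (slot s m ∷ l) with P? s
  ... | yes _ = Maybe.map (m ,_) (raise (slot s (just x)) l)
  ... | no _  = Maybe.map (map₂ (slot s m ∷_)) (bump l)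

  data Raised (i s : ℕ) (m : Maybe ℕ) (l : List Item) : Maybe (List Item) → Set where
    raised : ∀ {l′} → slots i l′ ↭ (suc i , s , m) ∷ slots i l → seps l′ ≡ seps l →
             i < i + seps l → length l′ ≡ suc (length l) → Raised i s m l (just l′)
    top    : seps l ≡ 0 → Raised i s m l nothing

  raise-raised : ∀ i s m l → Raised i s m l (raise (slot s m) l)
  raise-raised i s m []        = top refl
  raise-raised i s m (sep ∷ l) = raised ↭-refl refl (m<m+n i (s≤s z≤n)) refl
  raise-raised i s m (slot s′ m′ ∷ l) with raise (slot s m) l | raise-raised i s m l
  ... | _ | raised p sp i< len = raised (↭-trans (prep _ p) (swap _ _ ↭-refl)) sp i< (cong suc len)
  ... | _ | top sp             = top sp

  -- The order of the slots matters only for finding the least level. For the matching, one slot in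
  -- front of a common rest `r` is replaced, up to permutation.
  data Bumped (i : ℕ) (l : List Item) : Maybe (Maybe ℕ × List Item) → Set where
    bumped : ∀ {n s m r l′} → slots i l ↭ (n , s , m) ∷ r → slots i l′ ↭ (suc n , s , just x) ∷ r →
             P s → (∀ {n′ t m′} → (n′ , t , m′) ∈ slots i l → P t → n ≤ n′) →
             seps l′ ≡ seps l → n < i + seps l → length l′ ≡ length l → Bumped i l (just (m , l′))
    -- With `i = 0` and `|S| + 1` separators, this puts every neighbour of `x` above level `|S|`.
    stuck  : (∀ {n t m} → (n , t , m) ∈ slots i l → P t → i + seps l ≤ n) → Bumped i l nothing

  bump-bumped : ∀ i l → Bumped i l (bump l)
  bump-bumped i []        = stuck λ ()
  bump-bumped i (sep ∷ l) with bump l | bump-bumped (suc i) l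
  ... | _ | bumped {n} p q Ps min sp n< len =
    bumped p q Ps min (cong suc sp) (subst (n <_) (sym (+-suc i (seps l))) n<) (cong suc len)
  ... | _ | stuck high = stuck λ {n} n∈ Pt → subst (_≤ n) (sym (+-suc i (seps l))) (high n∈ Pt)
  bump-bumped i (slot s m ∷ l) with P? s
  ... | no ¬Ps with bump l | bump-bumped i l
  ...   | _ | bumped p q Ps min sp n< len =
    bumped (↭-trans (prep _ p) (swap _ _ ↭-refl)) (↭-trans (prep _ q) (swap _ _ ↭-refl)) Ps
      (λ { (here refl) Pt → ⊥-elim (¬Ps Pt) ; (there n∈) → min n∈ }) sp n< (cong suc len)
  ...   | _ | stuck high = stuck λ { (here refl) Pt → ⊥-elim (¬Ps Pt) ; (there n∈) → high n∈ }
  bump-bumped i (slot s m ∷ l) | yes Ps with raise (slot s (just x)) l | raise-raised i s (just x) l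
  ... | _ | raised p sp n< len = bumped ↭-refl p Ps (λ n∈ _ → slots-≥ {l = slot s m ∷ l} n∈) sp n< len
  ... | _ | top sp = stuck λ {n} n∈ _ →
    subst (_≤ n) (trans (sym (+-identityʳ i)) (cong (i +_) (sym sp))) (slots-≥ {l = slot s m ∷ l} n∈)

  -- An automaton for `bump`, since programs traverse lists by left folds: look for a neighbour,
  -- carry its slot to the next separator, then copy the rest. The part already passed is kept in
  -- reverse.
  data Scan : Set where
    seeking : List Item → Scan
    holding : ℕ → Maybe ℕ → List Item → Scan
    placed  : Maybe ℕ → List Item → Scan

  advance : Scan → Item → Scan
  advance (seeking a)     sep          = seeking (sep ∷ a)
  advance (seeking a)     (slot s m)   with P? s
  ... | yes _ = holding s m a
  ... | no _  = seeking (slot s m ∷ a)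
  advance (holding s m a) sep          = placed m (slot s (just x) ∷ sep ∷ a)
  advance (holding s m a) d@(slot _ _) = holding s m (d ∷ a)
  advance (placed m a)    d            = placed m (d ∷ a)

  finish : Scan → Maybe (Maybe ℕ × List Item)
  finish (placed m a) = just (m , reverse a)
  -- Either no neighbour was met, or the list ended before a separator for the held slot.
  finish _            = nothing

  finish-placed : ∀ m a l → finish (foldl advance (placed m a) l) ≡ just (m , a ʳ++ l)
  finish-placed m a []      = refl
  finish-placed m a (d ∷ l) = finish-placed m (d ∷ a) l

  finish-holding : ∀ s m a l → finish (foldl advance (holding s m a) l) ≡
                   Maybe.map (λ l′ → m , a ʳ++ l′) (raise (slot s (just x)) l)
  finish-holding s m a []        = refl
  finish-holding s m a (sep ∷ l) = finish-placed m (slot s (just x) ∷ sep ∷ a) l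
  finish-holding s m a (d@(slot _ _) ∷ l)
    with raise (slot s (just x)) l | finish-holding s m (d ∷ a) l
  ... | just _  | eq = eq
  ... | nothing | eq = eq

  finish-seeking : ∀ a l → finish (foldl advance (seeking a) l) ≡
                   Maybe.map (map₂ (a ʳ++_)) (bump l)
  finish-seeking a []        = refl
  finish-seeking a (sep ∷ l) with bump l | finish-seeking (sep ∷ a) l
  ... | just _  | eq = eq
  ... | nothing | eq = eq
  finish-seeking a (slot s m ∷ l) with P? s
  ... | yes _ with raise (slot s (just x)) l | finish-holding s m a l
  ...   | just _  | eq = eq
  ...   | nothing | eq = eq
  finish-seeking a (slot s m ∷ l) | no _ with bump l | finish-seeking (slot s m ∷ a) l
  ...   | just _  | eq = eq
  ...   | nothing | eq = eq

  finish-bump : ∀ l → finish (foldl advance (seeking []) l) ≡ bump l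
  finish-bump l with bump l | finish-seeking [] l
  ... | just _  | eq = eq
  ... | nothing | eq = eq

open Bump public

-- Scanning the slots by a program

encodeMate : Maybe ℕ → Tree
encodeMate nothing  = nil
encodeMate (just y) = atom y

encodeItem : Item → Tree
encodeItem sep        = nil
encodeItem (slot s m) = atom s ∙ encodeMate m

encodeItems : List Item → Tree
encodeItems = encodeList encodeItem

module _ (es : List (ℕ × ℕ)) (x : ℕ) where

  private
    Scanning : Set
    Scanning = Scan (linked? es x) x

  -- Two tests on the tag separate the phases: `nil` stands for seeking, and otherwise the tail of
  -- the tag is `nil` when holding and not `nil` when placed.
  encodeScan : Scanning → Tree
  encodeScan (seeking a)     = nil ∙ nil ∙ encodeItems a
  encodeScan (holding s m a) = (nil ∙ nil) ∙ encodeItem (slot s m) ∙ encodeItems a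
  encodeScan (placed m a)    = (nil ∙ nil ∙ nil) ∙ encodeMate m ∙ encodeItems a

phaseP heldP passP advanceP scanP : Program
phaseP   = accP ⨾ hd
heldP    = accP ⨾ tl ⨾ hd
passP    = ⟨ phaseP , ⟨ heldP , ⟨ itemP , accP ⨾ tl ⨾ tl ⟩ ⟩ ⟩
advanceP =
  if′ phaseP
  then (if′ (phaseP ⨾ tl)
        then passP
        else (if′ itemP
              then passP
              else ⟨ ⟨ nil′ , true′ ⟩ , ⟨ heldP ⨾ tl ,
                     ⟨ ⟨ heldP ⨾ hd , hd ⨾ hd ⨾ tl ⟩ , ⟨ nil′ , accP ⨾ tl ⨾ tl ⟩ ⟩ ⟩ ⟩))
  else (if′ itemP
        then (if′ (⟨ ⟨ hd ⨾ hd ⨾ tl , itemP ⨾ hd ⟩ , hd ⨾ hd ⨾ hd ⟩ ⨾ linkedP)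
              then ⟨ true′ , ⟨ itemP , accP ⨾ tl ⨾ tl ⟩ ⟩
              else passP)
        else passP)
scanP    = ⟨ ⟨ hd , ⟨ nil′ , ⟨ nil′ , nil′ ⟩ ⟩ ⟩ , tl ⟩ ⨾ foldP advanceP

run-advance : ∀ es x → length es ≤ N → ∀ a d r →
  Runs N advanceP (((encodeList encodeEdge es ∙ atom x) ∙ encodeScan es x a) ∙ (encodeItem d ∙ r))
                  (encodeScan es x (advance (linked? es x) x a d))
run-advance es x es≤ (seeking a)     sep        r = run-else straight (run-else straight straight)
run-advance es x es≤ (seeking a)     (slot s m) r
  with linked? es x s | run-linked es x s es≤
... | yes _ | h = run-else straight (run-then straight (λ ()) (run-then (straight run-⨾ h) (λ ()) straight))
... | no _  | h = run-else straight (run-then straight (λ ()) (run-else (straight run-⨾ h) straight))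
run-advance es x es≤ (holding s m a) sep        r =
  run-then straight (λ ()) (run-else straight (run-else straight straight))
run-advance es x es≤ (holding s m a) (slot _ _) r =
  run-then straight (λ ()) (run-else straight (run-then straight (λ ()) straight))
run-advance es x es≤ (placed m a)    d          r =
  run-then straight (λ ()) (run-then straight (λ ()) straight)

run-scan : ∀ es x l → length es ≤ N → length l ≤ N →
  Runs N scanP ((encodeList encodeEdge es ∙ atom x) ∙ encodeItems l)
               (encodeScan es x (foldl (advance (linked? es x) x) (seeking []) l))
run-scan es x l es≤ l≤ =
  straight run-⨾ run-fold {encodeA = encodeScan es x} (run-advance es x es≤) (seeking []) l l≤

-- Exchange along a crown

Unique-resp-↭ : ∀ {xs ys : List ℕ} → xs ↭ ys → Unique xs → Unique ys
Unique-resp-↭ p = ↭ₛ.Unique-resp-↭ (setoid ℕ) (↭⇒↭ₛ p)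

length-⊆ : ∀ {A : Set} {xs ys : List A} → Unique xs → xs ⊆ ys → length xs ≤ length ys
length-⊆ []                  _  = z≤n
length-⊆ {ys = ys} (x∉ ∷ u) ⊆ys with as , bs , refl ← ∈-∃++ (⊆ys (here refl)) =
  ≤-trans (s≤s (length-⊆ u λ y∈ → Any.tail (All.lookup x∉ y∈ ∘ sym)
            (∈-resp-↭ (shift _ as bs) (⊆ys (there y∈)))))
          (≤-reflexive (sym (↭-length (shift _ as bs))))

-- Pigeonhole on the numbers up to `length xs`. Applied to the levels of the slots, it yields the
-- empty level `g ≤ |S|`.
missing-value : ∀ xs → ∃[ g ] g ≤ length xs × g ∉ xs
missing-value xs with any? (_∉? xs) (upTo (suc (length xs)))
... | yes a with g , g∈ , g∉ ← find a = g , ≤-pred (∈-upTo⁻ g∈) , g∉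
... | no ¬a = ⊥-elim (<-irrefl refl (subst (_≤ length xs) (length-upTo (suc (length xs)))
  (length-⊆ (Unique.upTo⁺ (suc (length xs))) λ {g} g∈ →
    decidable-stable (g ∈? xs) λ g∉ → ¬a (lose g∈ g∉))))

Covers : (ℕ → ℕ → Set) → List ℕ → Set
Covers J T = ∀ {u v} → J u v → u ∈ T ⊎ v ∈ T

reassign : List (ℕ × ℕ) → ℕ → ℕ
reassign []             t = t
reassign ((d , y) ∷ ps) t with t ≟ y
... | yes _ = d
... | no _  = reassign ps t

reassign-∈ : ∀ ps {t} → (∃[ d ] (d , t) ∈ ps) → (reassign ps t , t) ∈ ps
reassign-∈ ((d , y) ∷ ps) {t} (e , e∈) with t ≟ y | e∈
... | yes refl | _         = here refl
... | no t≢    | here refl = ⊥-elim (t≢ refl)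
... | no _     | there e∈′ = there (reassign-∈ ps (e , e∈′))

reassign-∉ : ∀ ps {t} → (∀ {d} → (d , t) ∉ ps) → reassign ps t ≡ t
reassign-∉ []             _ = refl
reassign-∉ ((d , y) ∷ ps) {t} ∉ with t ≟ y
... | yes refl = ⊥-elim (∉ (here refl))
... | no _     = reassign-∉ ps (∉ ∘ there)

module _ {J : ℕ → ℕ → Set} {x : ℕ} {ps : List (ℕ × ℕ)} where

  private
    Inner : ℕ → Set
    Inner z = z ∈ x ∷ map proj₂ ps

  -- Replacing in a cover the mates by their partners covers all edges at x and
  -- at the mates, as the neighbourhood of these vertices consists of partners.
  exchange : (∀ {d e y} → (d , y) ∈ ps → (e , y) ∈ ps → d ≡ e) →
             (∀ {d e y} → (d , y) ∈ ps → (e , d) ∉ ps) →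
             (∀ {z v} → Inner z → J z v ⊎ J v z → ∃[ y ] (v , y) ∈ ps) →
             ∀ {T} → (∀ {d y} → (d , y) ∈ ps → d ∈ T ⊎ y ∈ T) →
             Covers (λ u v → J u v × u ≢ x × v ≢ x) T → Covers J (map (reassign ps) T)
  exchange functional apart closed {T} hit cover {u} {v} uv = covered
    where
    -- A partner is never a mate, hence fixed by `reassign`; if `T` contains its mate instead, that
    -- mate is sent to the partner.
    partner : ∀ {d} → (∃[ y ] (d , y) ∈ ps) → d ∈ map (reassign ps) T
    partner (y , dy∈) with hit dy∈
    ... | inj₁ d∈T = subst (_∈ _) (reassign-∉ ps (apart dy∈)) (∈-map⁺ (reassign ps) d∈T)
    ... | inj₂ y∈T = subst (_∈ _) (functional (reassign-∈ ps (_ , dy∈)) dy∈) (∈-map⁺ (reassign ps) y∈T)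

    keep : ∀ {t} → ¬ Inner t → t ∈ T → t ∈ map (reassign ps) T
    keep t∉ t∈ = subst (_∈ _) (reassign-∉ ps (λ d∈ → t∉ (there (∈-map⁺ proj₂ d∈))))
                   (∈-map⁺ (reassign ps) t∈)

    covered : u ∈ map (reassign ps) T ⊎ v ∈ map (reassign ps) T
    covered with u ∈? x ∷ map proj₂ ps | v ∈? x ∷ map proj₂ ps
    ... | yes u∈ | _      = inj₂ (partner (closed u∈ (inj₁ uv)))
    ... | no _   | yes v∈ = inj₁ (partner (closed v∈ (inj₂ uv)))
    ... | no u∉  | no v∉  =
      Sum.map (keep u∉) (keep v∉) (cover (uv , (λ u≡ → u∉ (here u≡)) , (λ v≡ → v∉ (here v≡))))

-- Mates and matched pairs of slots

mates : List Slot → List ℕ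
mates = mapMaybe (proj₂ ∘ proj₂)

mates-↭ : ∀ {r r′} → r ↭ r′ → mates r ↭ mates r′
mates-↭ p = catMaybes-↭ (map⁺ (proj₂ ∘ proj₂) p)

∈-mates : ∀ {r n s y} → (n , s , just y) ∈ r → y ∈ mates r
∈-mates {(_ , _ , just _) ∷ _}  (here refl) = here refl
∈-mates {(_ , _ , just _) ∷ _}  (there ∈r)  = there (∈-mates ∈r)
∈-mates {(_ , _ , nothing) ∷ _} (there ∈r)  = ∈-mates ∈r

mates-injective : ∀ {r n n′ s t y} → Unique (mates r) →
                  (n , s , just y) ∈ r → (n′ , t , just y) ∈ r → s ≡ t
mates-injective {(_ , _ , just _) ∷ _}  (y∉ ∷ u) (here refl) (here refl) = refl
mates-injective {(_ , _ , just _) ∷ _}  (y∉ ∷ u) (here refl) (there t∈)  =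
  ⊥-elim (All.lookup y∉ (∈-mates t∈) refl)
mates-injective {(_ , _ , just _) ∷ _}  (y∉ ∷ u) (there s∈)  (here refl) =
  ⊥-elim (All.lookup y∉ (∈-mates s∈) refl)
mates-injective {(_ , _ , just _) ∷ _}  (y∉ ∷ u) (there s∈)  (there t∈)  = mates-injective u s∈ t∈
mates-injective {(_ , _ , nothing) ∷ _} u        (there s∈)  (there t∈)  = mates-injective u s∈ t∈

length-mates : ∀ r → length (mates r) ≤ length r
length-mates []                       = z≤n
length-mates ((_ , _ , nothing) ∷ r) = ≤-trans (length-mates r) (n≤1+n _)
length-mates ((_ , _ , just _) ∷ r)  = s≤s (length-mates r)

-- In a matching the unmatched slots have level 0, so skipping them loses no slot above `g`.
pairsAbove : ℕ → List Slot → List (ℕ × ℕ)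
pairsAbove g []                       = []
pairsAbove g ((n , s , nothing) ∷ r) = pairsAbove g r
pairsAbove g ((n , s , just y) ∷ r) with g <? n
... | yes _ = (s , y) ∷ pairsAbove g r
... | no _  = pairsAbove g r

∈-pairsAbove⁺ : ∀ {g r n s y} → (n , s , just y) ∈ r → g < n → (s , y) ∈ pairsAbove g r
∈-pairsAbove⁺ {g} {(n , _ , just _) ∷ _} (here refl) g<n with g <? n
... | yes _  = here refl
... | no g≮n = ⊥-elim (g≮n g<n)
∈-pairsAbove⁺ {g} {(n , _ , just _) ∷ _} (there ∈r) g<n with g <? n
... | yes _ = there (∈-pairsAbove⁺ ∈r g<n)
... | no _  = ∈-pairsAbove⁺ ∈r g<n
∈-pairsAbove⁺ {g} {(n , _ , nothing) ∷ _} (there ∈r) g<n = ∈-pairsAbove⁺ ∈r g<n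

∈-pairsAbove⁻ : ∀ {g} r {s y} → (s , y) ∈ pairsAbove g r →
                ∃[ n ] g < n × (n , s , just y) ∈ r
∈-pairsAbove⁻ {g} ((n , _ , just _) ∷ r) sy∈ with g <? n | sy∈
... | yes g<n | here refl = n , g<n , here refl
... | yes _   | there sy∈′ with m , g<m , ∈r ← ∈-pairsAbove⁻ r sy∈′ = m , g<m , there ∈r
... | no _    | sy∈′ with m , g<m , ∈r ← ∈-pairsAbove⁻ r sy∈′ = m , g<m , there ∈r
∈-pairsAbove⁻ ((n , _ , nothing) ∷ r) sy∈ with m , g<m , ∈r ← ∈-pairsAbove⁻ r sy∈ = m , g<m , there ∈r

-- Partial matchings

edge-covered : ∀ {G S} → IsVertexCover G S → Covers (λ u v → (u , v) ∈ E G) S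
edge-covered {G} {S} vc {u} {v} e with u ∈? S | v ∈? S
... | yes u∈ | _      = inj₁ u∈
... | no _   | yes v∈ = inj₂ v∈
... | no u∉  | no v∉
  with () ← subst ((u , v) ∈_) (IsVertexCover.edgeless vc) (∈-filter⁺ _ {xs = E G} e (u∉ , v∉))

Linked⁺ˡ : ∀ {es x t} → (x , t) ∈ es → Linked es x t
Linked⁺ˡ e = lose e (inj₁ (refl , refl))

Linked⁺ʳ : ∀ {es x t} → (t , x) ∈ es → Linked es x t
Linked⁺ʳ e = lose e (inj₂ (refl , refl))

Linked⁻ : ∀ {es x t} → Linked es x t → (x , t) ∈ es ⊎ (t , x) ∈ es
Linked⁻ l with find l
... | _ , e , inj₁ (refl , refl) = inj₁ e
... | _ , e , inj₂ (refl , refl) = inj₂ e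

module _ {A : Set} where

  Unique-++⁻ˡ : ∀ (xs : List A) {ys} → Unique (xs ++ ys) → Unique xs
  Unique-++⁻ˡ []       _        = []
  Unique-++⁻ˡ (x ∷ xs) (x∉ ∷ u) = All.++⁻ˡ xs x∉ ∷ Unique-++⁻ˡ xs u

  Unique-++⁻ʳ : ∀ (xs : List A) {ys} → Unique (xs ++ ys) → Unique ys
  Unique-++⁻ʳ []       u       = u
  Unique-++⁻ʳ (x ∷ xs) (_ ∷ u) = Unique-++⁻ʳ xs u

  Unique-++-disjoint : ∀ {xs ys : List A} {x} → Unique (xs ++ ys) → x ∈ xs → x ∉ ys
  Unique-++-disjoint {y ∷ xs} (y∉ ∷ u) (here refl) y∈ys = All.lookup y∉ (∈-++⁺ʳ xs y∈ys) refl
  Unique-++-disjoint (_ ∷ u)  (there x∈)  x∈ys = Unique-++-disjoint u x∈ x∈ys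

partners : List Slot → List ℕ
partners = map (proj₁ ∘ proj₂)

release : Maybe ℕ → List ℕ → List ℕ
release m ps = maybe′ (_∷ ps) ps m

release-length : ∀ m ps → length (release m ps) ≤ suc (length ps)
release-length nothing  ps = n≤1+n _
release-length (just y) ps = ≤-refl

module _ {B : List ℕ} (G : BoundariedGraph B) {S : List ℕ} (vc : IsVertexCover (graph G) S) where

  private
    es = E (graph G)

  Joined : BoundariedGraph B → ℕ → ℕ → Set
  Joined H u v = (u , v) ∈ es ⊎ (u , v) ∈ E (graph H)

  Outside : ℕ → Set
  Outside v = v ∈ V (graph G) × v ∉ S × v ∉ B

  -- Covers are arbitrary lists here, possibly with repetitions or foreign vertices. The image of a
  -- cover under `reassign` is thus allowed as it stands, and only at the end is it cut down to a
  -- vertex cover.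
  Safe : List ℕ → Set
  Safe dr = ∀ (H : BoundariedGraph B) → Gluable G H → ∀ {T} →
            Covers (λ u v → Joined H u v × u ∉ dr × v ∉ dr) T →
            ∃[ T′ ] length T′ ≤ length T × Covers (Joined H) T′

  -- A vertex of `G` outside `B` is not in `H`, so the edge belongs to `G`, where `S` covers it at
  -- the other end.
  outside-neighbour : ∀ {H z v} → Gluable G H → Outside z → Joined H z v ⊎ Joined H v z →
                      v ∈ S × Linked es z v
  outside-neighbour {H} gl (z∈ , z∉S , z∉B) (inj₁ (inj₂ e)) =
    ⊥-elim (z∉B (proj₁ (gl z∈ (proj₁ (E-ends (graph H) e)))))
  outside-neighbour {H} gl (z∈ , z∉S , z∉B) (inj₂ (inj₂ e)) =
    ⊥-elim (z∉B (proj₁ (gl z∈ (proj₂ (E-ends (graph H) e)))))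
  outside-neighbour gl (z∈ , z∉S , z∉B) (inj₁ (inj₁ e)) with edge-covered {graph G} vc e
  ... | inj₁ z∈S = ⊥-elim (z∉S z∈S)
  ... | inj₂ v∈S = v∈S , Linked⁺ˡ e
  outside-neighbour gl (z∈ , z∉S , z∉B) (inj₂ (inj₁ e)) with edge-covered {graph G} vc e
  ... | inj₁ v∈S = v∈S , Linked⁺ʳ e
  ... | inj₂ z∈S = ⊥-elim (z∉S z∈S)

  -- All of `V (graph G)` starts as pending, so pending vertices may lie in `S` or `B`, and
  -- `outside` leaves them out. The slack of one in `near` arises because a partner rises when it is
  -- taken.
  record Matching (r : List Slot) (pending dropped : List ℕ) : Set where
    field
      names    : partners r ↭ S
      free     : ∀ {n s} → (n , s , nothing) ∈ r → n ≡ 0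
      linked   : ∀ {n s y} → (n , s , just y) ∈ r → Linked es y s
      near     : ∀ {n s y n′ t m} → (n , s , just y) ∈ r → (n′ , t , m) ∈ r →
                 Linked es y t → n ≤ suc n′
      distinct : Unique (pending ++ mates r ++ dropped)
      outside  : ∀ {v} → v ∈ mates r ++ dropped → Outside v
      pending⊆ : pending ⊆ V (graph G)
      total    : V (graph G) ⊆ S ++ B ++ pending ++ mates r ++ dropped
      safe     : Safe dropped

  open Matching

  Matching-resp-↭ : ∀ {r r′ ps dr} → r ↭ r′ → Matching r ps dr → Matching r′ ps dr
  Matching-resp-↭ {r} {r′} {ps} {dr} p M = record
    { names    = ↭-trans (map⁺ (proj₁ ∘ proj₂) (↭-sym p)) (names M)
    ; free     = free M ∘ back
    ; linked   = linked M ∘ back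
    ; near     = λ s∈ t∈ → near M (back s∈) (back t∈)
    ; distinct = Unique-resp-↭ (++⁺ˡ ps rest) (distinct M)
    ; outside  = outside M ∘ ∈-resp-↭ (↭-sym rest)
    ; pending⊆ = pending⊆ M
    ; total    = ∈-resp-↭ (++⁺ˡ S (++⁺ˡ B (++⁺ˡ ps rest))) ∘ total M
    ; safe     = safe M
    }
    where
    back : ∀ {a} → a ∈ r′ → a ∈ r
    back = ∈-resp-↭ (↭-sym p)

    rest : mates r ++ dr ↭ mates r′ ++ dr
    rest = ++⁺ʳ dr (mates-↭ p)

  -- The vertex can leave the pending list without a mate, as `total` still lists it under `S` or
  -- `B`.
  skip : ∀ {r x ps dr} → x ∈ S ⊎ x ∈ B → Matching r (x ∷ ps) dr → Matching r ps dr
  skip {r} {x} {ps} {dr} x∈ M with distinct M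
  ... | _ ∷ u = record
    { names    = names M
    ; free     = free M
    ; linked   = linked M
    ; near     = near M
    ; distinct = u
    ; outside  = outside M
    ; pending⊆ = pending⊆ M ∘ there
    ; total    = λ v∈ → rest x∈ (∈-++⁻ S (total M v∈))
    ; safe     = safe M
    }
    where
    rest : ∀ {v} → x ∈ S ⊎ x ∈ B → v ∈ S ⊎ v ∈ B ++ x ∷ ps ++ mates r ++ dr →
           v ∈ S ++ B ++ ps ++ mates r ++ dr
    rest x∈ (inj₁ v∈S) = ∈-++⁺ˡ v∈S
    rest x∈ (inj₂ v∈) with ∈-++⁻ B v∈
    rest x∈        (inj₂ _) | inj₁ v∈B         = ∈-++⁺ʳ S (∈-++⁺ˡ v∈B)
    rest (inj₁ x∈S) (inj₂ _) | inj₂ (here refl) = ∈-++⁺ˡ x∈S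
    rest (inj₂ x∈B) (inj₂ _) | inj₂ (here refl) = ∈-++⁺ʳ S (∈-++⁺ˡ x∈B)
    rest x∈        (inj₂ _) | inj₂ (there v∈)  = ∈-++⁺ʳ S (∈-++⁺ʳ B v∈)

  -- Levels never fall, so `near` is at stake only for the new pair, where `s` had least level among
  -- the neighbours of `x` before rising by one. A slot once matched stays matched, so unmatched
  -- slots keep level 0.
  assign : ∀ {n s m r x ps dr} → x ∉ S → x ∉ B → Linked es x s →
           (∀ {n′ t m′} → (n′ , t , m′) ∈ (n , s , m) ∷ r → Linked es x t → n ≤ n′) →
           Matching ((n , s , m) ∷ r) (x ∷ ps) dr →
           Matching ((suc n , s , just x) ∷ r) (release m ps) dr
  assign {n} {s} {m} {r} {x} {ps} {dr} x∉S x∉B xs least M = record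
    { names    = names M
    ; free     = λ { (there s∈) → free M (there s∈) }
    ; linked   = λ { (here refl) → xs ; (there s∈) → linked M (there s∈) }
    ; near     = λ { (here refl) (here refl) _  → n≤1+n _
                   ; (here refl) (there t∈)  xt → s≤s (least (there t∈) xt)
                   ; (there s∈)  (here refl) yt → ≤-trans (near M (there s∈) (here refl) yt) (n≤1+n _)
                   ; (there s∈)  (there t∈)  yt → near M (there s∈) (there t∈) yt }
    ; distinct = Unique-resp-↭ (moved m) (distinct M)
    ; outside  = λ { (here refl) → pending⊆ M (here refl) , x∉S , x∉B ; (there v∈) → outside M (matched m v∈) }
    ; pending⊆ = waiting m (λ v∈ → proj₁ (outside M v∈))
    ; total    = ∈-resp-↭ (++⁺ˡ S (++⁺ˡ B (moved m))) ∘ total M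
    ; safe     = safe M
    }
    where
    moved : ∀ m → x ∷ ps ++ mates ((n , s , m) ∷ r) ++ dr ↭
                  release m ps ++ x ∷ mates r ++ dr
    moved nothing  = ↭-sym (shift x ps _)
    moved (just y) = ↭-trans (prep x (shift y ps _))
                       (↭-trans (swap x y ↭-refl) (prep y (↭-sym (shift x ps _))))

    matched : ∀ m {v} → v ∈ mates r ++ dr → v ∈ mates ((n , s , m) ∷ r) ++ dr
    matched nothing  v∈ = v∈
    matched (just y) v∈ = there v∈

    waiting : ∀ m → (∀ {v} → v ∈ mates ((n , s , m) ∷ r) ++ dr → v ∈ V (graph G)) →
              release m ps ⊆ V (graph G)
    waiting nothing  _  v∈          = pending⊆ M (there v∈)
    waiting (just y) ∈V (here refl) = ∈V (here refl)
    waiting (just y) _  (there v∈)  = pending⊆ M (there v∈)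

  -- Vertices are restored in the reverse order of their removal: the exchange repairs the cover at
  -- `x` in the glued graph without `dr`, and safety of `dr` then takes care of the earlier ones.
  drop-safe : ∀ {r x ps dr} → x ∉ S → x ∉ B →
              (∀ {n t m} → (n , t , m) ∈ r → Linked es x t → length S < n) →
              Matching r (x ∷ ps) dr → Safe (x ∷ dr)
  drop-safe {r} {x} {ps} {dr} x∉S x∉B high M H gl {T} cover
    with g , g≤ , g∉ ← missing-value (map proj₁ r) =
    let T″ , T″≤ , cover″ = safe M H gl {map (reassign pairs) T} cover′
    in T″ , ≤-trans T″≤ (≤-reflexive (length-map (reassign pairs) T)) , cover″
    where
    -- No slot is at level g. The matched pairs above level g form a crown
    -- together with x: all neighbours of x and of their mates are above level g.
    pairs : List (ℕ × ℕ)
    pairs = pairsAbove g r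

    Inner : ℕ → Set
    Inner z = z ∈ x ∷ map proj₂ pairs

    inner-mate : ∀ {d y} → (d , y) ∈ pairs → y ∈ mates r
    inner-mate dy∈ with _ , _ , ∈r ← ∈-pairsAbove⁻ r dy∈ = ∈-mates ∈r

    partner∈S : ∀ {d y} → (d , y) ∈ pairs → d ∈ S
    partner∈S dy∈ with _ , _ , ∈r ← ∈-pairsAbove⁻ r dy∈ =
      ∈-resp-↭ (names M) (∈-map⁺ (proj₁ ∘ proj₂) ∈r)

    mate-outside : ∀ {y} → y ∈ mates r → Outside y
    mate-outside = outside M ∘ ∈-++⁺ˡ

    x-outside : Outside x
    x-outside = pending⊆ M (here refl) , x∉S , x∉B

    unique-rest : Unique (mates r ++ dr)
    unique-rest = Unique-++⁻ʳ (x ∷ ps) (distinct M)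

    slots-of : ∀ {t} → t ∈ S → ∃[ n ] ∃[ m ] (n , t , m) ∈ r
    slots-of t∈ with _ , ∈r , refl ← ∈-map⁻ (proj₁ ∘ proj₂) (∈-resp-↭ (↭-sym (names M)) t∈) =
      _ , _ , ∈r

    above : ∀ {z n t m} → Inner z → (n , t , m) ∈ r → Linked es z t → g < n
    -- There are `|S|` slots, hence `g ≤ |S|`, and `high` puts the neighbours of `x` beyond that.
    above (here refl) ∈r zt = ≤-trans (s≤s (≤-trans g≤ (≤-reflexive levels≡))) (high ∈r zt)
      where
      levels≡ : length (map proj₁ r) ≡ length S
      levels≡ = trans (length-map proj₁ r) (trans (sym (length-map (proj₁ ∘ proj₂) r)) (↭-length (names M)))
    -- The partner of this mate is above `g`, so by `near` all neighbours of the mate are at level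
    -- `g` or higher, and level `g` is empty.
    above (there z∈) ∈r zt with _ , dz∈ , refl ← ∈-map⁻ proj₂ z∈
      with k , g<k , z∈r ← ∈-pairsAbove⁻ r dz∈ =
      ≤∧≢⇒< (≤-pred (≤-trans g<k (near M z∈r ∈r zt)))
        (λ g≡n → g∉ (subst (_∈ _) (sym g≡n) (∈-map⁺ proj₁ ∈r)))

    closed′ : ∀ {z t} → Inner z → t ∈ S → Linked es z t → ∃[ y ] (t , y) ∈ pairs
    closed′ z∈ t∈ zt with slots-of t∈
    ... | n , just y , ∈r  = y , ∈-pairsAbove⁺ ∈r (above z∈ ∈r zt)
    ... | n , nothing , ∈r with () ← subst (g <_) (free M ∈r) (above z∈ ∈r zt)

    inner-outside : ∀ {z} → Inner z → Outside z
    inner-outside (here refl) = x-outside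
    inner-outside (there z∈) with _ , dz∈ , refl ← ∈-map⁻ proj₂ z∈ = mate-outside (inner-mate dz∈)

    J : ℕ → ℕ → Set
    J u v = Joined H u v × u ∉ dr × v ∉ dr

    closed : ∀ {z v} → Inner z → J z v ⊎ J v z → ∃[ y ] (v , y) ∈ pairs
    closed z∈ e with t∈ , zt ← outside-neighbour {H} gl (inner-outside z∈) (Sum.map proj₁ proj₁ e) =
      closed′ z∈ t∈ zt

    mate∉ : ∀ {y} → y ∈ mates r → y ∉ x ∷ dr
    mate∉ y∈ (here refl) =
      Unique-++-disjoint {xs = x ∷ ps} (distinct M) (here refl) (∈-++⁺ˡ y∈)
    mate∉ y∈ (there y∈dr) = Unique-++-disjoint unique-rest y∈ y∈dr

    partner∉ : ∀ {d} → d ∈ S → d ∉ x ∷ dr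
    partner∉ d∈ (here refl)  = x∉S d∈
    partner∉ d∈ (there d∈dr) = proj₁ (proj₂ (outside M (∈-++⁺ʳ (mates r) d∈dr))) d∈

    -- The edge between a partner and its mate avoids `x` and `dr`, so it is among those that `T`
    -- covers.
    hit : ∀ {d y} → (d , y) ∈ pairs → d ∈ T ⊎ y ∈ T
    hit {d} {y} dy∈ with _ , _ , ∈r ← ∈-pairsAbove⁻ r dy∈ with Linked⁻ (linked M ∈r)
    ... | inj₁ e = Sum.swap (cover (inj₁ e , mate∉ (inner-mate dy∈) , partner∉ (partner∈S dy∈)))
    ... | inj₂ e = cover (inj₁ e , partner∉ (partner∈S dy∈) , mate∉ (inner-mate dy∈))

    functional : ∀ {d e y} → (d , y) ∈ pairs → (e , y) ∈ pairs → d ≡ e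
    functional dy∈ ey∈
      with _ , _ , d∈r ← ∈-pairsAbove⁻ r dy∈ | _ , _ , e∈r ← ∈-pairsAbove⁻ r ey∈ =
      mates-injective (Unique-++⁻ˡ (mates r) unique-rest) d∈r e∈r

    cover′ : Covers J (map (reassign pairs) T)
    cover′ = exchange {J} {x} {pairs}
      functional
      (λ dy ed → proj₁ (proj₂ (mate-outside (inner-mate ed))) (partner∈S dy))
      closed hit
      (λ { ((uv , u∉ , v∉) , u≢x , v≢x) → cover (uv , avoid u≢x u∉ , avoid v≢x v∉) })
      where
      avoid : ∀ {u} → u ≢ x → u ∉ dr → u ∉ x ∷ dr
      avoid u≢x _   (here u≡x) = u≢x u≡x
      avoid _   u∉  (there u∈) = u∉ u∈

  discard : ∀ {r x ps dr} → x ∉ S → x ∉ B →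
            (∀ {n t m} → (n , t , m) ∈ r → Linked es x t → length S < n) →
            Matching r (x ∷ ps) dr → Matching r ps (x ∷ dr)
  discard {r} {x} {ps} {dr} x∉S x∉B high M = record
    { names    = names M
    ; free     = free M
    ; linked   = linked M
    ; near     = near M
    ; distinct = Unique-resp-↭ moved (distinct M)
    ; outside  = λ v∈ → dropped (∈-resp-↭ (shift x (mates r) dr) v∈)
    ; pending⊆ = pending⊆ M ∘ there
    ; total    = ∈-resp-↭ (++⁺ˡ S (++⁺ˡ B moved)) ∘ total M
    ; safe     = drop-safe x∉S x∉B high M
    }
    where
    moved : x ∷ ps ++ mates r ++ dr ↭ ps ++ mates r ++ x ∷ dr
    moved = ↭-trans (↭-sym (shift x ps _)) (++⁺ˡ ps (↭-sym (shift x (mates r) dr)))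

    dropped : ∀ {v} → v ∈ x ∷ mates r ++ dr → Outside v
    dropped (here refl) = pending⊆ M (here refl) , x∉S , x∉B
    dropped (there v∈)  = outside M v∈

-- The auction

record State : Set where
  constructor state
  field
    pending : List ℕ
    items   : List Item
    dropped : List ℕ

open State

-- One separator is there from the start and a fold over `S` adds one per element, a count that a
-- program can perform. The slots go in front, at level 0, and `|S| + 1` is the top level.
initialItems : List ℕ → List Item
initialItems S = foldl (λ l s → slot s nothing ∷ l) (foldl (λ l _ → sep ∷ l) (sep ∷ []) S) S

module _ (es : List (ℕ × ℕ)) (S B : List ℕ) where

  next : ℕ → List ℕ → List Item → List ℕ → State
  next x ps l dr with x ∈? S | x ∈? B | bump (linked? es x) x l
  ... | yes _ | _     | _             = state ps l dr
  ... | no _  | yes _ | _             = state ps l dr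
  ... | no _  | no _  | nothing       = state ps l (x ∷ dr)
  ... | no _  | no _  | just (m , l′) = state (release m ps) l′ dr

  -- Fuel makes the loop a total function; `potential` shows that it suffices to empty the pending
  -- list.
  assignAll : ℕ → State → State
  assignAll zero    st                    = st
  assignAll (suc n) st@(state [] l dr)    = st
  assignAll (suc n) (state (x ∷ ps) l dr) = assignAll n (next x ps l dr)

  encodeState : State → Tree
  encodeState (state ps l dr) =
    (encodeList encodeEdge es ∙ encodeSet S ∙ encodeSet B) ∙ encodeSet ps ∙ encodeItems l ∙ encodeSet dr

-- The auction step as a program

pendingP nextP restP itemsP droppedP skipP assignP stepP : Program
pendingP = tl ⨾ hd
nextP    = pendingP ⨾ hd
restP    = pendingP ⨾ tl
itemsP   = tl ⨾ tl ⨾ hd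
droppedP = tl ⨾ tl ⨾ tl
skipP    = ⟨ hd , ⟨ restP , tl ⨾ tl ⟩ ⟩
assignP  =
  -- The tag of the scan has a tail other than `nil` exactly when a slot was raised.
  if′ (tl ⨾ hd ⨾ tl)
  then ⟨ hd ⨾ hd ,
       ⟨ (if′ (tl ⨾ tl ⨾ hd) then ⟨ tl ⨾ tl ⨾ hd , hd ⨾ restP ⟩ else (hd ⨾ restP)) ,
       ⟨ tl ⨾ tl ⨾ tl ⨾ reverseP , hd ⨾ droppedP ⟩ ⟩ ⟩
  else ⟨ hd ⨾ hd , ⟨ hd ⨾ restP , ⟨ hd ⨾ itemsP , ⟨ hd ⨾ nextP , hd ⨾ droppedP ⟩ ⟩ ⟩ ⟩
stepP    =
  if′ (⟨ nextP , hd ⨾ tl ⨾ hd ⟩ ⨾ memberP)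
  then skipP
  else (if′ (⟨ nextP , hd ⨾ tl ⨾ tl ⟩ ⨾ memberP)
        then skipP
        else (⟨ id′ , ⟨ ⟨ hd ⨾ hd , nextP ⟩ , itemsP ⟩ ⨾ scanP ⟩ ⨾ assignP))

run-next : ∀ es S B x ps l dr → length es ≤ N → length S ≤ N → length B ≤ N → length l ≤ N →
  Runs N stepP (encodeState es S B (state (x ∷ ps) l dr)) (encodeState es S B (next es S B x ps l dr))
run-next {N} es S B x ps l dr es≤ S≤ B≤ l≤
  with x ∈? S | run-member {N} x S S≤ | x ∈? B | run-member {N} x B B≤
     | foldl (advance (linked? es x) x) (seeking []) l | run-scan {N} es x l es≤ l≤
     | bump (linked? es x) x l | finish-bump (linked? es x) x l | bump-bumped (linked? es x) x 0 l
... | yes _ | h | _     | _ | _ | _ | _ | _ | _ = run-then (straight run-⨾ h) (λ ()) straight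
... | no _  | h | yes _ | k | _ | _ | _ | _ | _ =
  run-else (straight run-⨾ h) (run-then (straight run-⨾ k) (λ ()) straight)
... | no _ | h | no _ | k | seeking a | scan | _ | refl | _ =
  run-else (straight run-⨾ h) (run-else (straight run-⨾ k)
    (run-pair straight (straight run-⨾ scan) run-⨾ run-else straight straight))
... | no _ | h | no _ | k | holding s m a | scan | _ | refl | _ =
  run-else (straight run-⨾ h) (run-else (straight run-⨾ k)
    (run-pair straight (straight run-⨾ scan) run-⨾ run-else straight straight))
-- Here `len` bounds the cost of undoing the reversal of the scanned list.
... | no _ | h | no _ | k | placed m a | scan | _ | refl | bumped _ _ _ _ _ _ len =
  run-else (straight run-⨾ h) (run-else (straight run-⨾ k)
    (run-pair straight (straight run-⨾ scan) run-⨾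
     run-then straight (λ ()) (run-pair straight (run-pair (push m) (run-pair
       (straight run-⨾ straight run-⨾ straight run-⨾ run-reverse a
         (≤-trans (≤-reflexive (trans (sym (length-reverse a)) len)) l≤)) straight)))))
  where
  push : ∀ m → Runs N _ (_ ∙ _ ∙ encodeMate m ∙ _) (encodeSet (release m ps))
  push nothing  = run-else straight straight
  push (just y) = run-then straight (λ ()) straight

-- Invariant and termination of the auction

module _ {B : List ℕ} (G : BoundariedGraph B) {S : List ℕ} (vc : IsVertexCover (graph G) S) where

  private
    es : List (ℕ × ℕ)
    es = E (graph G)

    height : ℕ
    height = suc (length S)

  record Invariant (st : State) : Set where
    field
      seps≡    : seps (items st) ≡ height
      length≡  : length (items st) ≡ length S + height
      matching : Matching G vc (slots 0 (items st)) (pending st) (dropped st)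

  open Invariant

  gaps : List Slot → ℕ
  gaps r = sum (map (λ a → height ∸ proj₁ a) r)

  -- Taking a partner may return its former mate to the pending list, but uses up one of the
  -- finitely many raises; skipping and discarding shorten the list.
  potential : State → ℕ
  potential st = length (pending st) + gaps (slots 0 (items st))

  next-invariant : ∀ {x ps l dr} → Invariant (state (x ∷ ps) l dr) →
    Invariant (next es S B x ps l dr) ×
    potential (next es S B x ps l dr) < potential (state (x ∷ ps) l dr)
  next-invariant {x} {ps} {l} {dr} inv
    with x ∈? S | x ∈? B | bump (linked? es x) x l | bump-bumped (linked? es x) x 0 l
  ... | yes x∈ | _      | _ | _ = record
    { seps≡ = seps≡ inv ; length≡ = length≡ inv ; matching = skip G vc (inj₁ x∈) (matching inv) } , ≤-refl
  ... | no _   | yes x∈ | _ | _ = record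
    { seps≡ = seps≡ inv ; length≡ = length≡ inv ; matching = skip G vc (inj₂ x∈) (matching inv) } , ≤-refl
  ... | no x∉S | no x∉B | _ | stuck high = record
    { seps≡ = seps≡ inv ; length≡ = length≡ inv
    ; matching = discard G vc x∉S x∉B (λ {n} n∈ xt → subst (_≤ n) (seps≡ inv) (high n∈ xt)) (matching inv)
    } , ≤-refl
  ... | no x∉S | no x∉B | _ | bumped {n} {s} {m} {r} {l′} p q xs least sp n< len = record
    { seps≡    = trans sp (seps≡ inv)
    ; length≡  = trans len (length≡ inv)
    ; matching = Matching-resp-↭ G vc (↭-sym q) (assign G vc x∉S x∉B xs
        (λ n∈ → least (∈-resp-↭ (↭-sym p) n∈)) (Matching-resp-↭ G vc p (matching inv)))
    } , decrease
    where
    open ≤-Reasoning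

    -- Only slots below the top level are raised, so the truncated subtraction is exact.
    gap≡ : height ∸ n ≡ suc (height ∸ suc n)
    gap≡ = +-∸-assoc 1 (≤-pred (subst (n <_) (seps≡ inv) n<))

    gaps-↭ : ∀ {r r′} → r ↭ r′ → gaps r ≡ gaps r′
    gaps-↭ p = sum-↭ (map⁺ _ p)

    decrease : length (release m ps) + gaps (slots 0 l′) < suc (length ps) + gaps (slots 0 l)
    decrease = begin-strict
      length (release m ps) + gaps (slots 0 l′)               ≤⟨ +-monoˡ-≤ _ (release-length m ps) ⟩
      suc (length ps) + gaps (slots 0 l′)                     ≡⟨ cong (suc (length ps) +_) (gaps-↭ q) ⟩
      suc (length ps) + ((height ∸ suc n) + gaps r)           <⟨ +-monoʳ-< (suc (length ps)) ≤-refl ⟩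
      suc (length ps) + (suc (height ∸ suc n) + gaps r)       ≡⟨ cong (λ k → suc (length ps) + (k + gaps r)) gap≡ ⟨
      suc (length ps) + (height ∸ n + gaps r)                 ≡⟨ cong (suc (length ps) +_) (gaps-↭ p) ⟨
      suc (length ps) + gaps (slots 0 l)                      ∎

  assignAll-invariant : ∀ n {st} → Invariant st → potential st ≤ n →
    Invariant (assignAll es S B n st) × pending (assignAll es S B n st) ≡ []
  -- Potential 0 leaves no pending vertex.
  assignAll-invariant zero    {state [] l dr}       inv _ = inv , refl
  assignAll-invariant (suc n) {state [] l dr}       inv _ = inv , refl
  assignAll-invariant (suc n) {state (x ∷ ps) l dr} inv ≤n with inv′ , lt ← next-invariant inv =
    assignAll-invariant n inv′ (≤-pred (≤-trans lt ≤n))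

  assignAll-loops : ∀ n {st} → Invariant st → potential st ≤ n →
    length es ≤ N → length S ≤ N → length B ≤ N → length S + height ≤ N →
    Loops N n pendingP stepP (encodeState es S B st) (encodeState es S B (assignAll es S B n st))
  assignAll-loops zero    {state [] l dr}       inv _ _ _ _ _ = loop-stop straight
  assignAll-loops (suc n) {state [] l dr}       inv _ _ _ _ _ = loop-stop straight
  assignAll-loops (suc n) {state (x ∷ ps) l dr} inv ≤n es≤ S≤ B≤ l≤ with inv′ , lt ← next-invariant inv =
    loop-step straight (λ ())
      (run-next es S B x ps l dr es≤ S≤ B≤ (≤-trans (≤-reflexive (length≡ inv)) l≤))
      (assignAll-loops n inv′ (≤-pred (≤-trans lt ≤n)) es≤ S≤ B≤ l≤)

-- Optimal vertex covers of glued graphs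

Edges : Graph → ℕ → ℕ → Set
Edges Γ u v = (u , v) ∈ E Γ

isVertexCover : ∀ {Γ S} → Unique S → S ⊆ V Γ → Covers (Edges Γ) S → IsVertexCover Γ S
isVertexCover {Γ} u S⊆ cover = record
  { S-unique = u
  ; S⊆V      = S⊆
  ; edgeless = filter-none _ {xs = E Γ} (All.tabulate λ e (u∉ , v∉) → Sum.[ u∉ , v∉ ] (cover e))
  }

-- Filtering `V Γ` by `T`, and not the other way round, removes repetitions and foreign vertices at
-- once.
restrict : Graph → List ℕ → List ℕ
restrict Γ T = filter (_∈? T) (V Γ)

restrict-⊆ : ∀ Γ T → restrict Γ T ⊆ V Γ
restrict-⊆ Γ T = proj₁ ∘ ∈-filter⁻ (_∈? T)

restrict-covers : ∀ Γ {T} → Covers (Edges Γ) T → Covers (Edges Γ) (restrict Γ T)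
restrict-covers Γ {T} cover e = Sum.map (∈-filter⁺ (_∈? T) (proj₁ (E-ends Γ e)))
                                        (∈-filter⁺ (_∈? T) (proj₂ (E-ends Γ e))) (cover e)

restrict-length : ∀ Γ T → length (restrict Γ T) ≤ length T
restrict-length Γ T = length-⊆ (Unique.filter⁺ (_∈? T) (V-unique Γ))
                               (proj₂ ∘ ∈-filter⁻ (_∈? T) {xs = V Γ})

restrict-isVertexCover : ∀ Γ {T} → Covers (Edges Γ) T → IsVertexCover Γ (restrict Γ T)
restrict-isVertexCover Γ {T} cover = isVertexCover {Γ} (Unique.filter⁺ (_∈? T) (V-unique Γ))
  (restrict-⊆ Γ T) (restrict-covers Γ cover)

sublists : List ℕ → List (List ℕ)
sublists []       = [] ∷ []
sublists (x ∷ xs) = sublists xs ++ map (x ∷_) (sublists xs)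

filter∈sublists : ∀ {P : ℕ → Set} (P? : Decidable P) xs → filter P? xs ∈ sublists xs
filter∈sublists P? []       = here refl
filter∈sublists P? (x ∷ xs) with does (P? x)
... | true  = ∈-++⁺ʳ (sublists xs) (∈-map⁺ (x ∷_) (filter∈sublists P? xs))
... | false = ∈-++⁺ˡ (filter∈sublists P? xs)

-- Exhaustive search, as `OPT` asks for a witness: restriction turns any covering list into a
-- sublist of `V Γ` that is no longer, and there are finitely many of these.
minimum-cover : ∀ Γ → ∃[ T ] Covers (Edges Γ) T ×
                              (∀ {T′} → Covers (Edges Γ) T′ → length T ≤ length T′)
minimum-cover Γ =
  least , All.lookup (Extrema.argmin-all length {P = All-covered} all-covered (All.all-filter covers? (sublists (V Γ)))) ,
  λ {T′} cover → ≤-trans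
    (All.lookup (Extrema.f[argmin]≤f[xs] {f = length} (V Γ) candidates)
      (∈-filter⁺ covers? (filter∈sublists (_∈? T′) (V Γ)) (All.tabulate (restrict-covers Γ cover))))
    (restrict-length Γ T′)
  where
  All-covered : List ℕ → Set
  All-covered T = All (λ e → proj₁ e ∈ T ⊎ proj₂ e ∈ T) (E Γ)

  covers? : Decidable All-covered
  covers? T = All.all? (λ e → (proj₁ e ∈? T) ⊎-dec (proj₂ e ∈? T)) (E Γ)

  candidates : List (List ℕ)
  candidates = filter covers? (sublists (V Γ))

  -- The default of `argmin` is `V Γ`, which covers every edge.
  least : List ℕ
  least = Extrema.argmin length (V Γ) candidates

  all-covered : All-covered (V Γ)
  all-covered = All.tabulate λ e → inj₁ (proj₁ (E-ends Γ e))

Edges-⊕⁻ : ∀ {B} (G H : BoundariedGraph B) {u v} →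
           Edges (G ⊕ H) u v → Edges (graph G) u v ⊎ Edges (graph H) u v
Edges-⊕⁻ G H e = ∈-++⁻ (E (graph G)) (∈-deduplicate⁻ _ _ e)

Edges-⊕⁺ : ∀ {B} (G H : BoundariedGraph B) {u v} →
           Edges (graph G) u v ⊎ Edges (graph H) u v → Edges (G ⊕ H) u v
Edges-⊕⁺ G H (inj₁ e) = ∈-deduplicate⁺ _ (∈-++⁺ˡ e)
Edges-⊕⁺ G H (inj₂ e) = ∈-deduplicate⁺ _ (∈-++⁺ʳ (E (graph G)) e)

module _ {B : List ℕ} (G : BoundariedGraph B) {S : List ℕ} (vc : IsVertexCover (graph G) S)
         (G′ : BoundariedGraph B) (dr : List ℕ) (G′≡ : graph G′ ≡ graph G − dr) where

  -- A cover of the original glued graph covers the reduced one, and safety gives the converse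
  -- without loss in size, so both optima equal `length T`.
  safe⇒equivalent : Safe G vc dr → GluingEquivalentWithOffset VertexCover G G′ (ℤ.+ 0)
  safe⇒equivalent safe H gl _ with minimum-cover (G′ ⊕ H)
  ... | T , cover , least with safe H gl {T} (λ (uv , u∉ , v∉) → cover (Edges-⊕⁺ G′ H (kept uv u∉ v∉)))
    where
    kept : ∀ {u v} → Joined G vc H u v → u ∉ dr → v ∉ dr → Edges (graph G′) u v ⊎ Edges (graph H) u v
    kept (inj₁ e) u∉ v∉ rewrite G′≡ = inj₁ (∈-filter⁺ _ {xs = E (graph G)} e (u∉ , v∉))
    kept (inj₂ e) _  _  = inj₂ e
  ... | T₁ , T₁≤ , cover₁ = _ , optimal s′ (restrict-isVertexCover Γ′ cover) (λ t t-vc →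
            ≤-trans (restrict-length Γ′ T) (least (edge-covered t-vc))) ,
          subst (λ k → OPT VertexCover Γ (fin k)) offset≡ (optimal s s-vc s-least)
    where
    Γ Γ′ : Graph
    Γ  = G ⊕ H
    Γ′ = G′ ⊕ H

    s s′ : List ℕ
    s  = restrict Γ T₁
    s′ = restrict Γ′ T

    Γ′⊆Γ : ∀ {u v} → Edges Γ′ u v → Edges Γ u v
    Γ′⊆Γ e = Edges-⊕⁺ G H (Sum.map₁ old (Edges-⊕⁻ G′ H e))
      where
      old : ∀ {u v} → Edges (graph G′) u v → Edges (graph G) u v
      old e rewrite G′≡ = proj₁ (∈-filter⁻ _ {xs = E (graph G)} e)

    s-vc : IsVertexCover Γ s
    s-vc = restrict-isVertexCover Γ (λ e → cover₁ (Edges-⊕⁻ G H e))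

    T≤ : ∀ {t} → IsVertexCover Γ t → length T ≤ length t
    T≤ t-vc = least (λ e → edge-covered t-vc (Γ′⊆Γ e))

    s≤T : length s ≤ length T
    s≤T = ≤-trans (restrict-length Γ T₁) T₁≤

    s-least : ∀ t → IsVertexCover Γ t → length s ≤ length t
    s-least t t-vc = ≤-trans s≤T (T≤ t-vc)

    s≡s′ : length s ≡ length s′
    s≡s′ = ≤-antisym (≤-trans s≤T (least (restrict-covers Γ′ cover)))
                     (≤-trans (restrict-length Γ′ T) (T≤ s-vc))

    offset≡ : ℤ.+ length s ≡ ℤ.+ length s′ ℤ.+ ℤ.+ 0
    offset≡ = trans (cong ℤ.+_ s≡s′) (sym (ℤ.+-identityʳ _))

-- The kernelization

unmatched : ℕ → Slot
unmatched s = 0 , s , nothing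

length-foldl-∷ : ∀ {A C : Set} (g : A → C) cs xs →
                 length (foldl (λ cs x → g x ∷ cs) cs xs) ≡ length xs + length cs
length-foldl-∷ g cs []       = refl
length-foldl-∷ g cs (x ∷ xs) = trans (length-foldl-∷ g (g x ∷ cs) xs) (+-suc (length xs) (length cs))

module _ (xs : List ℕ) where

  private
    addSeps addSlots : List Item → List ℕ → List Item
    addSeps  = foldl (λ l _ → sep ∷ l)
    addSlots = foldl (λ l s → slot s nothing ∷ l)

    slots-addSeps : ∀ l xs → (∀ i → slots i l ≡ []) → slots 0 (addSeps l xs) ≡ []
    slots-addSeps l []       empty = empty 0
    slots-addSeps l (x ∷ xs) empty = slots-addSeps (sep ∷ l) xs (empty ∘ suc)

    seps-addSeps : ∀ l xs → seps (addSeps l xs) ≡ length xs + seps l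
    seps-addSeps l []       = refl
    seps-addSeps l (x ∷ xs) = trans (seps-addSeps (sep ∷ l) xs) (+-suc (length xs) (seps l))

    slots-addSlots : ∀ l xs → slots 0 (addSlots l xs) ↭ map unmatched xs ++ slots 0 l
    slots-addSlots l []       = ↭-refl
    slots-addSlots l (x ∷ xs) =
      ↭-trans (slots-addSlots (slot x nothing ∷ l) xs) (shift (unmatched x) (map unmatched xs) _)

    seps-addSlots : ∀ l xs → seps (addSlots l xs) ≡ seps l
    seps-addSlots l []       = refl
    seps-addSlots l (x ∷ xs) = seps-addSlots (slot x nothing ∷ l) xs

  slots-initial : slots 0 (initialItems xs) ↭ map unmatched xs
  slots-initial = ↭-trans (slots-addSlots _ xs)
    (↭-reflexive (trans (cong (map unmatched xs ++_) (slots-addSeps (sep ∷ []) xs (λ _ → refl)))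
                        (++-identityʳ _)))

  seps-initial : seps (initialItems xs) ≡ suc (length xs)
  seps-initial = trans (seps-addSlots _ xs) (trans (seps-addSeps (sep ∷ []) xs) (+-comm (length xs) 1))

  length-initial : length (initialItems xs) ≡ length xs + suc (length xs)
  length-initial = trans (length-foldl-∷ _ _ xs)
    (cong (length xs +_) (trans (length-foldl-∷ _ (sep ∷ []) xs) (+-comm (length xs) 1)))

mates-unmatched : ∀ xs → mates (map unmatched xs) ≡ []
mates-unmatched []       = refl
mates-unmatched (x ∷ xs) = mates-unmatched xs

partners-unmatched : ∀ xs → partners (map unmatched xs) ≡ xs
partners-unmatched xs = trans (sym (map-∘ xs)) (map-id xs)

length≤size : ∀ {A : Set} (encode : A → Tree) xs → length xs ≤ size (encodeList encode xs)
length≤size encode []       = z≤n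
length≤size encode (x ∷ xs) = s≤s (≤-trans (length≤size encode xs) (m≤n+m _ _))

size-encodeList : ∀ {A : Set} (encode : A → Tree) {c} → (∀ x → size (encode x) ≡ c) →
                  ∀ xs → size (encodeList encode xs) ≡ suc (length xs * suc c)
size-encodeList encode         size≡ []       = refl
size-encodeList encode {c = c} size≡ (x ∷ xs) = cong suc
  (trans (cong₂ _+_ (size≡ x) (size-encodeList encode size≡ xs)) (+-suc c _))

size-filter : ∀ {A : Set} (encode : A → Tree) {P : A → Set} (P? : Decidable P) xs →
              size (encodeList encode (filter P? xs)) ≤ size (encodeList encode xs)
size-filter encode P? []       = ≤-refl
size-filter encode P? (x ∷ xs) with does (P? x)
... | true  = s≤s (+-monoʳ-≤ (size (encode x)) (size-filter encode P? xs))
... | false = ≤-trans (size-filter encode P? xs) (≤-trans (m≤n+m _ _) (n≤1+n _))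

length-cartesianProduct : ∀ {A C : Set} (xs : List A) (ys : List C) →
                          length (cartesianProduct xs ys) ≡ length xs * length ys
length-cartesianProduct []       ys = refl
length-cartesianProduct (x ∷ xs) ys = trans (length-++ (map (x ,_) ys))
  (cong₂ _+_ (length-map (x ,_) ys) (length-cartesianProduct xs ys))

-- The kernelization as a program

initP outputP algorithmP : Program
initP      =
  ⟨ ⟨ hd ⨾ hd ⨾ tl , ⟨ tl , hd ⨾ tl ⟩ ⟩ , ⟨ hd ⨾ hd ⨾ hd ,
  -- The inner fold starts from `sep ∷ []` and adds the other separators; the outer one puts the
  -- slots in front.
  ⟨ ⟨ ⟨ nil′ , ⟨ ⟨ nil′ , ⟨ nil′ , nil′ ⟩ ⟩ , tl ⟩ ⨾ foldP ⟨ nil′ , accP ⟩ ⟩ , tl ⟩ ⨾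
      foldP ⟨ ⟨ itemP , nil′ ⟩ , accP ⟩ , nil′ ⟩ ⟩ ⟩
outputP    =
  ⟨ ⟨ ⟨ ⟨ tl , hd ⨾ hd ⨾ hd ⨾ hd ⟩ ⨾ filterP (⟨ tl , hd ⟩ ⨾ memberP) ,
        ⟨ tl , hd ⨾ hd ⨾ hd ⨾ tl ⟩ ⨾
        filterP (if′ (⟨ tl ⨾ hd , hd ⟩ ⨾ memberP) then true′ else (⟨ tl ⨾ tl , hd ⟩ ⨾ memberP)) ⟩ ,
      hd ⨾ hd ⨾ tl ⟩ ,
    -- The trailing `nil ∙ nil` encodes the offset 0.
    ⟨ hd ⨾ tl , ⟨ nil′ , nil′ ⟩ ⟩ ⟩
algorithmP = ⟨ id′ , initP ⨾ (while pendingP do′ stepP) ⨾ droppedP ⟩ ⨾ outputP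

run-output : ∀ G {B S dr} → length (V G) ≤ N → length (E G) ≤ N → length dr ≤ N →
  Runs N outputP (((encodeGraph G ∙ encodeSet B) ∙ encodeSet S) ∙ encodeSet dr)
                 ((encodeGraph (G − dr) ∙ encodeSet B) ∙ encodeSet S ∙ nil ∙ nil)
run-output {N} G {dr = dr} V≤ E≤ dr≤ = run-pair (run-pair (run-pair
    (straight run-⨾ run-filter (_∉? dr) (λ v → does (v ∈? dr)) (λ _ → refl)
      (λ v → straight run-⨾ run-member v dr dr≤) (V G) V≤)
    (straight run-⨾ run-filter _ (λ (u , v) → does (u ∈? dr) ∨ does (v ∈? dr))
      (λ (u , v) → deMorgan (does (u ∈? dr)) (does (v ∈? dr))) touches (E G) E≤))
    straight) straight
  where
  deMorgan : ∀ a b → not a ∧ not b ≡ not (a ∨ b)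
  deMorgan true  b = refl
  deMorgan false b = refl

  touches : ∀ e → Runs N (if′ (⟨ tl ⨾ hd , hd ⟩ ⨾ memberP) then true′ else (⟨ tl ⨾ tl , hd ⟩ ⨾ memberP))
                    (encodeSet dr ∙ encodeEdge e)
                    (encodeBool (does (proj₁ e ∈? dr) ∨ does (proj₂ e ∈? dr)))
  touches (u , v) with does (u ∈? dr) | run-member {N} u dr dr≤
  ... | true  | h = run-then (straight run-⨾ h) (λ ()) straight
  ... | false | h = run-else (straight run-⨾ h) (straight run-⨾ run-member v dr dr≤)

run-init : ∀ G {B S} → length S ≤ N →
  Runs N initP ((encodeGraph G ∙ encodeSet B) ∙ encodeSet S)
               (encodeState (E G) S B (state (V G) (initialItems S) []))
run-init {N} G {S = S} S≤ = run-pair straight (run-pair straight (run-pair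
  (run-pair (run-pair straight
    (straight run-⨾ run-fold {encodeA = encodeItems} {encodeC = atom} (λ _ _ _ → straight) (sep ∷ []) S S≤))
    straight run-⨾
    run-fold {encodeA = encodeItems} {encodeC = atom} (λ _ _ _ → straight) (foldl (λ l _ → sep ∷ l) (sep ∷ []) S) S S≤)
  straight))

size-∙ˡ : ∀ x y → size x ≤ size (x ∙ y)
size-∙ˡ x y = ≤-trans (m≤m+n (size x) (size y)) (n≤1+n _)

size-∙ʳ : ∀ x y → size y ≤ size (x ∙ y)
size-∙ʳ x y = ≤-trans (m≤n+m (size y) (size x)) (n≤1+n _)

module Kernel {B : List ℕ} (G : BoundariedGraph B) {S : List ℕ} (vc : IsVertexCover (graph G) S) where

  private
    Γ : Graph
    Γ = graph G

    height : ℕ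
    height = suc (length S)

  start : State
  start = state (V Γ) (initialItems S) []

  start-matching : Matching G vc (map unmatched S) (V Γ) []
  start-matching = record
    { names    = ↭-reflexive (partners-unmatched S)
    ; free     = λ s∈ → free (∈-map⁻ unmatched s∈)
    ; linked   = λ s∈ → ⊥-elim (absurd s∈)
    ; near     = λ s∈ → ⊥-elim (absurd s∈)
    ; distinct = subst Unique (sym start≡) (V-unique Γ)
    ; outside  = λ v∈ → ⊥-elim (none v∈)
    ; pending⊆ = id
    ; total    = λ v∈ → ∈-++⁺ʳ S (∈-++⁺ʳ B (∈-++⁺ˡ v∈))
    ; safe     = λ H gl {T} cover → T , ≤-refl , λ e → cover (e , (λ ()) , λ ())
    }
    where
    free : ∀ {n s m} → (∃[ t ] t ∈ S × (n , s , m) ≡ unmatched t) → n ≡ 0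
    free (_ , _ , refl) = refl

    absurd : ∀ {n s y} → (n , s , just y) ∉ map unmatched S
    absurd s∈ with ∈-map⁻ unmatched s∈
    ... | _ , _ , ()

    none : ∀ {v} → v ∉ mates (map unmatched S) ++ []
    none v∈ rewrite mates-unmatched S with () ← v∈

    start≡ : V Γ ++ mates (map unmatched S) ++ [] ≡ V Γ
    start≡ rewrite mates-unmatched S = ++-identityʳ (V Γ)

  start-invariant : Invariant G vc start
  start-invariant = record
    { seps≡    = seps-initial S
    ; length≡  = length-initial S
    ; matching = Matching-resp-↭ G vc (↭-sym (slots-initial S)) start-matching
    }

  fuel : ℕ
  fuel = length (V Γ) + length S * height

  start-potential : potential G vc start ≤ fuel
  start-potential = ≤-reflexive (cong (length (V Γ) +_)
    (trans (sum-↭ (map⁺ _ (slots-initial S))) (gaps-unmatched S)))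
    where
    gaps-unmatched : ∀ xs → gaps G vc (map unmatched xs) ≡ length xs * height
    gaps-unmatched []       = refl
    gaps-unmatched (x ∷ xs) = cong (height +_) (gaps-unmatched xs)

  end : State
  end = assignAll (E Γ) S B fuel start

  dr : List ℕ
  dr = State.dropped end

  private
    end-invariant : Invariant G vc end × State.pending end ≡ []
    end-invariant = assignAll-invariant G vc fuel start-invariant start-potential

    r : List Slot
    r = slots 0 (State.items end)

  end-matching : Matching G vc r [] dr
  end-matching = subst (λ ps → Matching G vc r ps dr) (proj₂ end-invariant)
                   (Invariant.matching (proj₁ end-invariant))

  open Matching end-matching

  kernelGraph : BoundariedGraph B
  kernelGraph = record
    { graph    = Γ − dr
    ; B-unique = B-unique G
    ; B⊆V      = λ b∈ → ∈-filter⁺ (_∉? dr) (B⊆V G b∈)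
                   (λ b∈dr → proj₂ (proj₂ (outside (∈-++⁺ʳ (mates r) b∈dr))) b∈)
    }

  kernel-isVertexCover : IsVertexCover (Γ − dr) S
  kernel-isVertexCover = isVertexCover {Γ − dr} (IsVertexCover.S-unique vc)
    (λ s∈ → ∈-filter⁺ (_∉? dr) (IsVertexCover.S⊆V vc s∈)
      (λ s∈dr → proj₁ (proj₂ (outside (∈-++⁺ʳ (mates r) s∈dr))) s∈))
    (λ e → edge-covered vc (proj₁ (∈-filter⁻ _ {xs = E Γ} e)))

  kernel-equivalent : GluingEquivalentWithOffset VertexCover G kernelGraph (ℤ.+ 0)
  kernel-equivalent = safe⇒equivalent G vc kernelGraph dr refl safe

  -- Remaining vertices outside `S` and `B` are mates, at most one per vertex of `S`, which gives
  -- even `|B| + 2|S|`.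
  kernel-vertices : length (V (Γ − dr)) ≤ 2 * (length B + length S)
  kernel-vertices = begin
    length (V (Γ − dr))                           ≤⟨ length-⊆ (V-unique (Γ − dr)) kept ⟩
    length (S ++ B ++ mates r)                    ≡⟨ length-++ S ⟩
    length S + length (B ++ mates r)              ≡⟨ cong (length S +_) (length-++ B) ⟩
    length S + (length B + length (mates r))      ≤⟨ +-monoʳ-≤ (length S) (+-monoʳ-≤ (length B) mates≤) ⟩
    length S + (length B + length S)              ≤⟨ +-mono-≤ (m≤n+m (length S) (length B)) (m≤m+n _ 0) ⟩
    2 * (length B + length S)                     ∎
    where
    open ≤-Reasoning

    mates≤ : length (mates r) ≤ length S
    mates≤ = ≤-trans (length-mates r)
      (≤-reflexive (trans (sym (length-map (proj₁ ∘ proj₂) r)) (↭-length names)))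

    kept : V (Γ − dr) ⊆ S ++ B ++ mates r
    kept v∈ with v∈V , v∉dr ← ∈-filter⁻ (_∉? dr) {xs = V Γ} v∈ with ∈-++⁻ S (total v∈V)
    ... | inj₁ v∈S = ∈-++⁺ˡ v∈S
    ... | inj₂ v∈′ with ∈-++⁻ B v∈′
    ...   | inj₁ v∈B = ∈-++⁺ʳ S (∈-++⁺ˡ v∈B)
    ...   | inj₂ v∈″ with ∈-++⁻ (mates r) v∈″
    ...     | inj₁ v∈r  = ∈-++⁺ʳ S (∈-++⁺ʳ B v∈r)
    ...     | inj₂ v∈dr = ⊥-elim (v∉dr v∈dr)

  private
    input : Tree
    input = encodeInput VertexCover G S

    n : ℕ
    n = size input

    encodedG encodedGB : Tree
    encodedG  = encodeGraph Γ
    encodedGB = encodeBoundaried G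

    G≤ : size encodedG ≤ n
    G≤ = ≤-trans (size-∙ˡ encodedG (encodeSet B)) (size-∙ˡ encodedGB (encodeSet S))

    V≤ : length (V Γ) ≤ n
    V≤ = ≤-trans (length≤size atom (V Γ))
           (≤-trans (size-∙ˡ (encodeSet (V Γ)) (encodeList encodeEdge (E Γ))) G≤)

    E≤ : length (E Γ) ≤ n
    E≤ = ≤-trans (length≤size encodeEdge (E Γ))
           (≤-trans (size-∙ʳ (encodeSet (V Γ)) (encodeList encodeEdge (E Γ))) G≤)

    B≤ : length B ≤ n
    B≤ = ≤-trans (length≤size atom B)
           (≤-trans (size-∙ʳ encodedG (encodeSet B)) (size-∙ˡ encodedGB (encodeSet S)))

    -- A list of `|S|` atoms has size `2|S| + 1`, which is exactly `|S| + height`.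
    items≤ : length S + height ≤ n
    items≤ = ≤-trans (≤-reflexive (trans (+-suc (length S) (length S)) (trans
      (cong suc (trans (cong (length S +_) (sym (+-identityʳ (length S)))) (*-comm 2 (length S))))
      (sym (size-encodeList atom (λ _ → refl) S))))) (size-∙ʳ encodedGB (encodeSet S))

    S≤ : length S ≤ n
    S≤ = ≤-trans (m≤m+n (length S) height) items≤

    fuel≤ : fuel ≤ ⟦ loops ⟧ n
    fuel≤ = +-mono-≤ V≤ (*-mono-≤ S≤ (≤-trans (m≤n+m height (length S)) items≤))

    dr≤ : length dr ≤ n
    dr≤ = ≤-trans (length-⊆ (Unique-++⁻ʳ (mates r) distinct)
                    (λ v∈ → proj₁ (outside (∈-++⁺ʳ (mates r) v∈)))) V≤

  kernelOutput : KernelOutput VertexCover B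
  kernelOutput = output kernelGraph S (ℤ.+ 0)

  run-algorithm : Runs n algorithmP input (encodeOutput VertexCover kernelOutput)
  run-algorithm = run-pair straight (run-init Γ S≤ run-⨾
      run-while fuel≤ (assignAll-loops G vc fuel start-invariant start-potential E≤ S≤ B≤ items≤) run-⨾
      straight)
    run-⨾ run-output Γ V≤ E≤ dr≤

  -- Beyond a part no larger than the input, the output has only the offset, of size 3, and one more
  -- pairing node.
  output-size : size (encodeOutput VertexCover kernelOutput) ≤ n + 4
  output-size = begin
    suc (size (encodeBoundaried kernelGraph) + suc (size (encodeSet S) + 3))
      ≤⟨ s≤s (+-mono-≤ (s≤s (+-monoˡ-≤ (size (encodeSet B)) (s≤s (+-mono-≤
           (size-filter atom _ (V Γ)) (size-filter encodeEdge _ (E Γ))))))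
           (≤-reflexive (sym (+-suc (size (encodeSet S)) 3)))) ⟩
    suc (size encodedGB + (size (encodeSet S) + 4))
      ≡⟨ cong suc (+-assoc (size encodedGB) _ 4) ⟨
    n + 4 ∎
    where open ≤-Reasoning

-- `W` bounds the number of vertices and `W :* W` that of edges. A vertex takes 2 nodes, its atom
-- and a list cell; an edge takes 4.
sizeBound : Polynomial
sizeBound = con 1 :+ ((con 1 :+ W :* con 2) :+ (con 1 :+ W :* W :* con 4))
  where
  W : Polynomial
  W = con 2 :* X

size-graph : ∀ Γ → size (encodeGraph Γ) ≡ suc (suc (length (V Γ) * 2) + suc (length (E Γ) * 4))
size-graph Γ = cong suc (cong₂ _+_ (size-encodeList atom (λ _ → refl) (V Γ))
                                   (size-encodeList encodeEdge (λ _ → refl) (E Γ)))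

edges≤ : ∀ Γ → length (E Γ) ≤ length (V Γ) * length (V Γ)
edges≤ Γ = ≤-trans
  (length-⊆ (E-unique Γ) (λ e → ∈-cartesianProduct⁺ (proj₁ (E-ends Γ e)) (proj₂ (E-ends Γ e))))
  (≤-reflexive (length-cartesianProduct (V Γ) (V Γ)))

module _ {B : List ℕ} (G : BoundariedGraph B) {S : List ℕ} (vc : IsVertexCover (graph G) S) where

  open Kernel G vc

  kernel-isKernel : IsKernel VertexCover VertexCover ⟦ sizeBound ⟧ G S kernelOutput
  kernel-isKernel = record
    { feasible   = kernel-isVertexCover
    ; equivalent = kernel-equivalent
    ; graph≤     = ≤-trans (≤-reflexive (size-graph (graph G − dr)))
        (s≤s (+-mono-≤ (s≤s (*-monoˡ-≤ 2 kernel-vertices))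
          (s≤s (*-monoˡ-≤ 4 (≤-trans (edges≤ (graph G − dr)) (*-mono-≤ kernel-vertices kernel-vertices))))))
    ; solution≤  = ≤-trans (≤-reflexive (size-encodeList atom (λ _ → refl) S))
        (≤-trans (s≤s (*-monoˡ-≤ 2 S≤2n)) (≤-trans (m≤m+n _ _) (n≤1+n _)))
    ; value≤     = ≤-trans S≤2n (≤-trans (m≤m*n _ 2) (≤-trans (n≤1+n _) (≤-trans (m≤m+n _ _) (n≤1+n _))))
    }
    where
    S≤2n : length S ≤ 2 * (length B + length S)
    S≤2n = ≤-trans (m≤n+m (length S) (length B)) (m≤m+n _ _)

vertexCoverKernelization : PolynomialBoundariedKernelization VertexCover VertexCover
vertexCoverKernelization = record
  { f             = ⟦ sizeBound ⟧
  ; polynomial    = sizeBound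
  ; f≤polynomial  = λ _ → ≤-refl
  ; kernelization = record
    { algorithm = algorithmP
    -- The summand `X :+ con 4` pays for writing out the result.
    ; time      = bound algorithmP :+ (X :+ con 4)
    ; result    = λ G S vc → Kernel.kernelOutput G vc
    ; computes  = λ G S vc → let runs h h≤ = Kernel.run-algorithm G vc in
                    _ , h , +-mono-≤ h≤ (Kernel.output-size G vc)
    ; correct   = λ G S vc → kernel-isKernel G vc
    }
  }

mainTheorem3 :
  Σ (PolynomialBoundariedKernelization VertexCover VertexCover) λ K →
    ∀ {B : List ℕ} (G : BoundariedGraph B) (S : List ℕ)
      (vc : IsVertexCover (graph G) S) →
    length (V (graph (kernel (result (kernelization K) G S vc))))
      ≤ 2 * (length B + length S)
mainTheorem3 = vertexCoverKernelization , λ G S vc → Kernel.kernel-vertices G vc
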